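{- Let $r$ and $s$ be integers each of which is positive or odd. Then for every integer $n\ge0$ with $n\ne-(r+s)/2$ and all integers $\alpha,\beta$ with $0\le\alpha,\beta\le n$, $$\delta_{\alpha+\beta,n-1}+\sum_{\substack{\ell\ge\alpha,\ m\ge\beta\\ \ell+m=n}}b_r(\ell,\alpha)\,b_s(m,\beta)=\sum_{k=0}^n b_{r+s}(n,k)\Big(b_r(k-\beta,\alpha)+b_s(k-\alpha,\beta)\Big).$$
   Context: $\delta_{i,j}$ is the Kronecker delta and $B_j$ are the Bernoulli numbers, $\frac{t}{e^t-1}=\sum_j B_j\frac{t^j}{j!}$. For $q\in\mathbb{Z}$, integers $n\ge0$ with $n\ne -q/2$, and $0\le i\le n$, define $$b_q(n,i):=\begin{cases}\frac{2}{2n+q}\binom{2n+q}{2i+q}B_{2(n-i)}, & n\ge\max\{0,\lfloor -q/2\rfloor+1\},\\ \frac{2}{2i+q}\binom{ -2i-q}{ -2n-q}B_{2(n-i)}, & 0\le n\le\lfloor-(q+1)/2\rfloor,\end{cases}$$ with $\binom{N}{j}=0$ for $j<0$; and set $b_q(n,i):=0$ whenever $n<0$ or $i>n$. (The paper denotes $b_q(n,i)$ by ${n\brack i}_q$.) -}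

module Defs where

open import Data.Bool.Base using (if_then_else_; _∧_)
open import Data.Fin.Base as Fin using (Fin; toℕ)
open import Data.Integer.Base as ℤ using (ℤ; +_; -[1+_])
import Data.Integer.Properties as ℤₚ
open import Data.Integer.Divisibility using (_∣_)
open import Data.Nat.Base as ℕ using (ℕ; zero; suc; _∸_; _!)
open import Data.Nat.Combinatorics using (_C_)
import Data.Nat.Properties as ℕₚ
open import Data.Rational.Base using (ℚ; _/_; _+_; _*_; -_; 0ℚ; 1ℚ; toℚᵘ)
import Data.Rational.Properties as ℚₚ
import Data.Rational.Unnormalised.Base as ℚᵘ
import Data.Rational.Unnormalised.Properties as ℚᵘₚ
open import Data.Sum.Base using (_⊎_)
open import Data.Vec.Base using (Vec; []; _∷_; head; lookup)
open import Relation.Binary.PropositionalEquality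
open import Relation.Nullary.Decidable.Core using (does)
open import Relation.Nullary.Negation.Core using (¬_)

open import Algebra.Properties.Monoid.Sum ℚₚ.+-0-monoid using (sum-cong-≗)
open import Algebra.Properties.Monoid.Sum ℚₚ.+-0-monoid public using (sum; sum⁺-syntax)

-- A series f stands for the formal power series Σₖ f(k) tᵏ.
PowerSeries : Set
PowerSeries = ℕ → ℚ

infixl 7 _⊛_

_⊛_ : PowerSeries → PowerSeries → PowerSeries
(f ⊛ g) n = ∑[ k ≤ n ] (f (toℕ k) * g (n ∸ toℕ k))

𝟙 : PowerSeries
𝟙 zero    = 1ℚ
𝟙 (suc _) = 0ℚ

-- f / t, for f with zero constant term.
_/t : PowerSeries → PowerSeries
(f /t) k = f (suc k)

t : PowerSeries
t zero    = 0ℚ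
t (suc k) = 𝟙 k

1/_! : ℕ → ℚ
1/ k ! = (+ 1 / (k !)) {{k ℕₚ.!≢0}}

exp-1 : PowerSeries
exp-1 zero    = 0ℚ
exp-1 (suc k) = 1/ suc k !

egf : (ℕ → ℚ) → PowerSeries
egf a j = a j * 1/ j !

-- The coefficients of tⁿ, …, t⁰ (in this order) in 1 / f, for f with constant
-- term 1.
recipCoeffs : PowerSeries → (n : ℕ) → Vec ℚ (suc n)
recipCoeffs f zero    = 1ℚ ∷ []
recipCoeffs f (suc n) =
  - (∑[ k ≤ n ] (f (suc (toℕ k)) * lookup (recipCoeffs f n) k)) ∷ recipCoeffs f n

recip : PowerSeries → PowerSeries
recip f n = head (recipCoeffs f n)

-- t / (eᵗ - 1) = Σⱼ B j tʲ / j!  (see B-egf below); in particular B 1 = - 1/2.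
B : ℕ → ℚ
B j = (+ (j !) / 1) * recip (exp-1 /t) j

private
  lookup-recip : ∀ f n (k : Fin (suc n)) → lookup (recipCoeffs f n) k ≡ recip f (n ∸ toℕ k)
  lookup-recip f zero    Fin.zero    = refl
  lookup-recip f (suc n) Fin.zero    = refl
  lookup-recip f (suc n) (Fin.suc k) = lookup-recip f n k

  sum-cong : ∀ {n} {f g : Fin n → ℚ} → (∀ k → f k ≡ g k) → sum f ≡ sum g
  sum-cong = sum-cong-≗

  n!*1/n! : ∀ n → (+ (n !) / 1) * 1/ n ! ≡ 1ℚ
  n!*1/n! n = go (n !) {{n ℕₚ.!≢0}}
    where
    go : ∀ d .{{_ : ℕ.NonZero d}} → (+ d / 1) * (+ 1 / d) ≡ 1ℚ
    go d@(suc d-1) = ℚₚ.toℚᵘ-injective (begin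
      toℚᵘ ((+ d / 1) * (+ 1 / d))           ≈⟨ ℚₚ.toℚᵘ-homo-* (+ d / 1) (+ 1 / d) ⟩
      toℚᵘ (+ d / 1) ℚᵘ.* toℚᵘ (+ 1 / d)     ≈⟨ ℚᵘₚ.*-cong (ℚₚ.toℚᵘ-fromℚᵘ (ℚᵘ.mkℚᵘ (+ d) 0)) (ℚₚ.toℚᵘ-fromℚᵘ (ℚᵘ.mkℚᵘ (+ 1) d-1)) ⟩
      ℚᵘ.mkℚᵘ (+ d) 0 ℚᵘ.* ℚᵘ.mkℚᵘ (+ 1) d-1 ≈⟨ ℚᵘ.*≡* (trans (ℤₚ.*-identityʳ (+ d ℤ.* + 1)) (trans (ℤₚ.*-identityʳ (+ d)) (sym (trans (ℤₚ.*-identityˡ (+ (1 ℕ.* d))) (cong +_ (ℕₚ.*-identityˡ d)))))) ⟩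
      ℚᵘ.1ℚᵘ                                 ∎)
      where open ℚᵘₚ.≃-Reasoning

  egf-B : ∀ j → egf B j ≡ recip (exp-1 /t) j
  egf-B j = begin
    (+ (j !) / 1) * x * 1/ j !    ≡⟨ ℚₚ.*-assoc (+ (j !) / 1) x (1/ j !) ⟩
    (+ (j !) / 1) * (x * 1/ j !)  ≡⟨ cong ((+ (j !) / 1) *_) (ℚₚ.*-comm x (1/ j !)) ⟩
    (+ (j !) / 1) * (1/ j ! * x)  ≡⟨ ℚₚ.*-assoc (+ (j !) / 1) (1/ j !) x ⟨
    (+ (j !) / 1) * 1/ j ! * x    ≡⟨ cong (_* x) (n!*1/n! j) ⟩
    1ℚ * x                        ≡⟨ ℚₚ.*-identityˡ x ⟩
    x                             ∎
    where open ≡-Reasoning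
          x = recip (exp-1 /t) j

⊛-recip : ∀ f → f 0 ≡ 1ℚ → ∀ n → (f ⊛ recip f) n ≡ 𝟙 n
⊛-recip f f0≡1 zero    = begin
  f 0 * 1ℚ + 0ℚ  ≡⟨ cong (λ x → x * 1ℚ + 0ℚ) f0≡1 ⟩
  1ℚ             ∎
  where open ≡-Reasoning
⊛-recip f f0≡1 (suc n) = begin
  f 0 * - S + S′  ≡⟨ cong (λ x → x * - S + S′) f0≡1 ⟩
  1ℚ * - S + S′   ≡⟨ cong (_+ S′) (ℚₚ.*-identityˡ (- S)) ⟩
  - S + S′        ≡⟨ cong (λ x → - S + x) (sum-cong (λ k → cong (f (suc (toℕ k)) *_) (lookup-recip f n k))) ⟨
  - S + S         ≡⟨ ℚₚ.+-inverseˡ S ⟩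
  0ℚ              ∎
  where
  open ≡-Reasoning
  S S′ : ℚ
  S  = ∑[ k ≤ n ] (f (suc (toℕ k)) * lookup (recipCoeffs f n) k)
  S′ = ∑[ k ≤ n ] (f (suc (toℕ k)) * recip f (n ∸ toℕ k))

B-egf : ∀ n → (exp-1 ⊛ egf B) n ≡ t n
B-egf zero    = trans (ℚₚ.+-identityʳ _) (ℚₚ.*-zeroˡ (egf B 0))
B-egf (suc n) = begin
  0ℚ * egf B (suc n) + S        ≡⟨ cong (_+ S) (ℚₚ.*-zeroˡ (egf B (suc n))) ⟩
  0ℚ + S                        ≡⟨ ℚₚ.+-identityˡ S ⟩
  S                             ≡⟨ sum-cong {suc n} (λ k → cong ((exp-1 /t) (toℕ k) *_) (egf-B (n ∸ toℕ k))) ⟩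
  (exp-1 /t ⊛ recip (exp-1 /t)) n  ≡⟨ ⊛-recip (exp-1 /t) refl n ⟩
  𝟙 n                           ∎
  where
  open ≡-Reasoning
  S : ℚ
  S = (exp-1 /t ⊛ egf B) n

δ : ℤ → ℤ → ℚ
δ i j = if does (i ℤₚ.≟ j) then 1ℚ else 0ℚ

-- Binomial coefficient with value 0 for negative lower argument. The upper
-- argument is never negative where this is used.
binom : ℤ → ℤ → ℕ
binom (+ N)    (+ j)    = N C j
binom (+ N)    -[1+ _ ] = 0
binom -[1+ _ ] _        = 0

infixl 7 _÷_

-- Quotient of two integers; the value for denominator 0 is never used.
_÷_ : ℤ → ℤ → ℚ
a ÷ (+ zero)  = 0ℚ
a ÷ (+ suc d) = a / suc d
a ÷ -[1+ d ]  = (ℤ.- a) / suc d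

⌊_/2⌋ : ℤ → ℤ
⌊ a /2⌋ = a ℤ./ℕ 2

-- The second argument is an integer, as negative values do occur. The last
-- branch is reached only for n = - q / 2, where b is undefined.
b : ℤ → ℤ → ℕ → ℚ
b q -[1+ _ ] i = 0ℚ
b q (+ n)    i =
  if n ℕ.<ᵇ i then 0ℚ
  else if (+ 0 ℤ.⊔ (⌊ ℤ.- q /2⌋ ℤ.+ + 1)) ℤ.≤ᵇ + n then
    (+ 2 ÷ 2n+q) * (+ binom 2n+q 2i+q / 1) * B (2 ℕ.* (n ∸ i))
  else if + n ℤ.≤ᵇ ⌊ ℤ.- (q ℤ.+ + 1) /2⌋ then
    (+ 2 ÷ 2i+q) * (+ binom (ℤ.- 2i+q) (ℤ.- 2n+q) / 1) * B (2 ℕ.* (n ∸ i))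
  else 0ℚ
  where
  2n+q 2i+q : ℤ
  2n+q = + 2 ℤ.* + n ℤ.+ q
  2i+q = + 2 ℤ.* + i ℤ.+ q

PositiveOrOdd : ℤ → Set
PositiveOrOdd q = (+ 0 ℤ.< q) ⊎ (¬ (+ 2 ∣ q))

-- Σ f(ℓ, m) over all ℓ ≥ α, m ≥ β with ℓ + m = n.
sumSplit : (n α β : ℕ) → (ℕ → ℕ → ℚ) → ℚ
sumSplit n α β f =
  ∑[ ℓ ≤ n ] (if (α ℕ.≤ᵇ toℕ ℓ) ∧ (β ℕ.≤ᵇ n ∸ toℕ ℓ) then f (toℕ ℓ) (n ∸ toℕ ℓ) else 0ℚ)

{-# OPTIONS --safe #-}

-- Put x = 2α + r, y = 2β + s, N = n - α - β, and let γₖ be the coefficients of the even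
-- series G(t) = (t / 2) coth (t / 2). Writing x⁽ᵏ⁾ for the rising factorial, both cases in
-- the definition of b give (2n + q) b_q(n, i) = 2 γ₂ⱼ (2i + q + 1)⁽²ʲ⁾ with j = n - i.
-- After multiplication by x y (x + y + 2N) the theorem therefore becomes
--   (x + y + 2N) (Σ_{u+v=N} γ₂ᵤ γ₂ᵥ x⁽²ᵘ⁾ y⁽²ᵛ⁾ + δ_{N,1} x y / 4)
--     = Σ_{k+w=N} γ₂ₖ γ₂_w (x + y + 2w + 1)⁽²ᵏ⁾ (x⁽²ʷ⁾ y + x y⁽²ʷ⁾).
-- This is the image of the addition theorem of coth,
--   (a + b) (G(a) G(b) + a b / 4) = G(a + b) (b G(a) + a G(b)),
-- under the linear map aⁱ bʲ ↦ x⁽ⁱ⁾ y⁽ʲ⁾, which turns multiplication by a + b on forms of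
-- degree d into multiplication by x + y + d. The map is evaluation at the constant
-- function 1 of the commuting operators a : φ ↦ x φ(x + 1, y) and b : φ ↦ y φ(x, y + 1).
module Submission where

open import Defs
open import Algebra.Bundles using (CommutativeMonoid; CommutativeRing; CommutativeSemiring)
import Algebra.Construct.Pointwise as Pointwise
open import Algebra.Structures.Biased using (isCommutativeSemiringˡ)
open import Data.Bool.Base using (T; true; false; if_then_else_; _∧_)
open import Data.Bool.Properties using (∧-zeroʳ)
open import Data.Empty using (⊥-elim)
open import Data.Fin.Base using (toℕ)
open import Data.Integer.Base as ℤ using (ℤ; +_; -[1+_])
import Data.Integer.DivMod as ℤ
import Data.Integer.Properties as ℤₚ
import Data.Integer.Solver as ℤSolver
open import Data.Nat.Base as ℕ using (ℕ; zero; suc; _!; _∸_)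
open import Data.Nat.Combinatorics using (_C_; nCk≡n!/k![n-k]!; [n∸k]!k!∣n!)
import Data.Nat.Divisibility as ℕ
import Data.Nat.DivMod as ℕ
import Data.Nat.Properties as ℕₚ
open import Data.Product.Base using (∃; _,_)
open import Data.Rational.Base as ℚ using (ℚ; 0ℚ; 1ℚ; ½; -½)
import Data.Rational.Properties as ℚₚ
open import Data.Rational.Solver using (module +-*-Solver)
import Data.Rational.Unnormalised.Base as ℚᵘ
import Data.Rational.Unnormalised.Properties as ℚᵘₚ
open import Data.Sum.Base using (inj₁; inj₂)
open import Function.Base using (flip)
open import Relation.Binary.Definitions using (Tri; tri<; tri≈; tri>)
open import Relation.Binary.PropositionalEquality using (_≡_; _≢_)
import Relation.Binary.PropositionalEquality as ≡
open import Relation.Binary.Structures using (IsEquivalence)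
open import Relation.Nullary.Decidable using (Dec; dec-true; dec-false; yes; no)
open import Relation.Nullary.Negation.Core using (¬_)

-- Power series

-- The obstacle is that x⁽ⁱ⁾ x⁽ʲ⁾ differs from x⁽ⁱ⁺ʲ⁾, so numbers cannot be substituted for a and b
-- in the addition theorem; operators can, since the k-th power of a sends 1 to x⁽ᵏ⁾. The addition
-- theorem is therefore proved over an arbitrary commutative semiring with a map from ℚ, starting
-- from the product rule for exponentials and without subtracting or dividing by a or b. The
-- multipliers can be cancelled at the end: x = 0 would make r = -2α, which is neither positive nor
-- odd, the same holds for y and s, and x + y + 2N is 2n + r + s. Comparing coefficients gives sums
-- over all indices. Only even ones remain because γ vanishes at odd indices, which is itself the
-- addition theorem at b = -a. The Kronecker delta is the term a b / 4, which lives in degree 2 = 2N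
-- only. For negative N, that is n < α + β, every term of the theorem is 0.

module Convolution {c ℓ} (M : CommutativeMonoid c ℓ) where
  open CommutativeMonoid M renaming (_∙_ to _+_; ε to 0#; ∙-cong to +-cong; ∙-congˡ to +-congˡ; ∙-congʳ to +-congʳ; assoc to +-assoc; comm to +-comm; identityˡ to +-identityˡ; identityʳ to +-identityʳ)
  open import Algebra.Properties.CommutativeSemigroup commutativeSemigroup using (interchange)
  open import Relation.Binary.Reasoning.Setoid setoid

  -- Σ F(i, j) over all i, j with i + j = n.
  conv : ℕ → (ℕ → ℕ → Carrier) → Carrier
  conv zero    F = F 0 0
  conv (suc n) F = F 0 (suc n) + conv n (λ i j → F (suc i) j)

  conv-cong : ∀ n {F G} → (∀ i j → i ℕ.+ j ≡ n → F i j ≈ G i j) → conv n F ≈ conv n G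
  conv-cong zero    eq = eq 0 0 ≡.refl
  conv-cong (suc n) eq = +-cong (eq 0 (suc n) ≡.refl) (conv-cong n (λ i j e → eq (suc i) j (≡.cong suc e)))

  conv-cong′ : ∀ n {F G} → (∀ i j → F i j ≈ G i j) → conv n F ≈ conv n G
  conv-cong′ n eq = conv-cong n (λ i j _ → eq i j)

  conv-0 : ∀ n {F} → (∀ i j → i ℕ.+ j ≡ n → F i j ≈ 0#) → conv n F ≈ 0#
  conv-0 zero    eq = eq 0 0 ≡.refl
  conv-0 (suc n) eq = trans (+-cong (eq 0 (suc n) ≡.refl) (conv-0 n (λ i j e → eq (suc i) j (≡.cong suc e)))) (+-identityˡ 0#)

  conv-+ : ∀ n F G → conv n (λ i j → F i j + G i j) ≈ conv n F + conv n G
  conv-+ zero    F G = refl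
  conv-+ (suc n) F G = trans (+-congˡ (conv-+ n _ _)) (interchange _ _ _ _)

  conv-last : ∀ n F → conv (suc n) F ≈ conv n (λ i j → F i (suc j)) + F (suc n) 0
  conv-last zero    F = refl
  conv-last (suc n) F = trans (+-congˡ (conv-last n (λ i → F (suc i)))) (sym (+-assoc _ _ _))

  conv-flip : ∀ n F → conv n F ≈ conv n (flip F)
  conv-flip zero    F = refl
  conv-flip (suc n) F = begin
    F 0 (suc n) + conv n (λ i j → F (suc i) j)          ≈⟨ +-congˡ (conv-flip n _) ⟩
    F 0 (suc n) + conv n (λ i j → F (suc j) i)          ≈⟨ +-comm _ _ ⟩
    conv n (λ i j → F (suc j) i) + F 0 (suc n)          ≈⟨ conv-last n (flip F) ⟨
    conv (suc n) (flip F)                               ∎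

  -- Both sides run over all triples k + l + j = n. In the inductive step the triples with k = 0 are
  -- collected first; they form `conv (suc n) (F 0)`.
  conv-assoc : ∀ n (F : ℕ → ℕ → ℕ → Carrier) →
    conv n (λ i j → conv i (λ k l → F k l j)) ≈ conv n (λ k m → conv m (F k))
  conv-assoc zero    F = refl
  conv-assoc (suc n) F = begin
    F 0 0 (suc n) + conv n (λ i j → F 0 (suc i) j + conv i (λ k l → F (suc k) l j))
      ≈⟨ +-congˡ (conv-+ n _ _) ⟩
    F 0 0 (suc n) + (conv n (λ i j → F 0 (suc i) j) + conv n (λ i j → conv i (λ k l → F (suc k) l j)))
      ≈⟨ +-assoc _ _ _ ⟨
    conv (suc n) (F 0) + conv n (λ i j → conv i (λ k l → F (suc k) l j))
      ≈⟨ +-congˡ (conv-assoc n _) ⟩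
    conv (suc n) (F 0) + conv n (λ k m → conv m (F (suc k)))
      ∎

module SeriesSemiring {c ℓ} (R : CommutativeSemiring c ℓ) where
  open CommutativeSemiring R
  open Convolution +-commutativeMonoid public
  open import Relation.Binary.Reasoning.Setoid setoid

  conv-*ˡ : ∀ n x F → x * conv n F ≈ conv n (λ i j → x * F i j)
  conv-*ˡ zero    x F = refl
  conv-*ˡ (suc n) x F = trans (distribˡ _ _ _) (+-congˡ (conv-*ˡ n x _))

  conv-*ʳ : ∀ n x F → conv n F * x ≈ conv n (λ i j → F i j * x)
  conv-*ʳ zero    x F = refl
  conv-*ʳ (suc n) x F = trans (distribʳ _ _ _) (+-congˡ (conv-*ʳ n x _))

  Series : Set c
  Series = ℕ → Carrier

  infixl 7 _⊗_
  _⊗_ : Series → Series → Series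
  (f ⊗ g) n = conv n (λ i j → f i * g j)

  const : Carrier → Series
  const x zero    = x
  const x (suc _) = 0#

  infixr 8 t·_
  t·_ : Series → Series
  (t· f) zero    = 0#
  (t· f) (suc n) = f n

  const-⊗ : ∀ x f n → (const x ⊗ f) n ≈ x * f n
  const-⊗ x f zero    = refl
  const-⊗ x f (suc n) = trans (+-congˡ (conv-0 n (λ i j _ → zeroˡ _))) (+-identityʳ _)

  t·-⊗ : ∀ f g n → (t· f ⊗ g) n ≈ (t· (f ⊗ g)) n
  t·-⊗ f g zero    = zeroˡ _
  t·-⊗ f g (suc n) = trans (+-congʳ (zeroˡ _)) (+-identityˡ _)

  ⊗-assoc : ∀ f g h n → ((f ⊗ g) ⊗ h) n ≈ (f ⊗ (g ⊗ h)) n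
  ⊗-assoc f g h n = begin
    conv n (λ i j → conv i (λ k l → f k * g l) * h j)  ≈⟨ conv-cong′ n (λ i j → trans (conv-*ʳ i _ _) (conv-cong′ i (λ k l → *-assoc _ _ _))) ⟩
    conv n (λ i j → conv i (λ k l → f k * (g l * h j))) ≈⟨ conv-assoc n (λ k l j → f k * (g l * h j)) ⟩
    conv n (λ k m → conv m (λ l j → f k * (g l * h j))) ≈⟨ conv-cong′ n (λ k m → sym (conv-*ˡ m _ _)) ⟩
    conv n (λ k m → f k * conv m (λ l j → g l * h j))  ∎

  ⊗-comm : ∀ f g n → (f ⊗ g) n ≈ (g ⊗ f) n
  ⊗-comm f g n = trans (conv-flip n _) (conv-cong′ n (λ _ _ → *-comm _ _))

  -- With this structure the semiring solver and `CothAddition` apply to power series as to elements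
  -- of any commutative semiring.
  seriesSemiring : CommutativeSemiring c ℓ
  seriesSemiring = record
    { Carrier = Series
    ; _≈_ = λ f g → ∀ n → f n ≈ g n
    ; _+_ = λ f g n → f n + g n
    ; _*_ = _⊗_
    ; 0# = λ _ → 0#
    ; 1# = const 1#
    ; isCommutativeSemiring = isCommutativeSemiringˡ (record
      { +-isCommutativeMonoid = Pointwise.isCommutativeMonoid ℕ +-isCommutativeMonoid
      ; *-isCommutativeMonoid = record
        { isMonoid = record
          { isSemigroup = record
            { isMagma = record
              { isEquivalence = Pointwise.isEquivalence ℕ isEquivalence
              ; ∙-cong = λ f≈g h≈k n → conv-cong′ n (λ i j → *-cong (f≈g i) (h≈k j))
              }
            ; assoc = ⊗-assoc
            }
          ; identity = 1-⊗ , (λ f n → trans (⊗-comm f _ n) (1-⊗ f n))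
          }
        ; comm = ⊗-comm
        }
      ; distribʳ = λ f g h n → trans (conv-cong′ n (λ i j → distribʳ _ _ _)) (conv-+ n _ _)
      ; zeroˡ = λ f n → conv-0 n (λ i j _ → zeroˡ _)
      })
    }
    where
    1-⊗ : ∀ f n → (const 1# ⊗ f) n ≈ f n
    1-⊗ f n = trans (const-⊗ 1# f n) (*-identityˡ _)

-- Read U_x = (eˣᵗ - 1) / (x t), W_x = 1 / U_x and G_x = W_x + x t / 2 = (x t / 2) coth (x t / 2)
-- for x = a, b, a + b.
module CothAddition {c ℓ} (S : CommutativeSemiring c ℓ) where
  open CommutativeSemiring S
  open import Algebra.Solver.Ring.NaturalCoefficients.Default S using (solve; _:+_; _:*_; _:=_)
  open import Relation.Binary.Reasoning.Setoid setoid

  [1+x]*[1+y] : ∀ x y → (1# + x) * (1# + y) ≈ 1# + (x + y + x * y)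
  [1+x]*[1+y] x y = trans
    (solve 3 (λ o x y → (o :+ x) :* (o :+ y) := o :* o :+ (o :* x :+ o :* y :+ x :* y)) refl 1# x y)
    (+-cong (*-identityˡ _) (+-congʳ (+-cong (*-identityˡ x) (*-identityˡ y))))

  -- For c = a + b the last hypothesis is the expansion of eᶜᵗ - 1 = (1 + (eᵃᵗ - 1)) (1 + (eᵇᵗ - 1))
  -- - 1, divided by t. Multiplying it by the three reciprocals gives the conclusion.
  recip-addition : ∀ {a b c t Uₐ U_b U_c Wₐ W_b W_c} →
    Uₐ * Wₐ ≈ 1# → U_b * W_b ≈ 1# → U_c * W_c ≈ 1# →
    c * U_c ≈ a * Uₐ + b * U_b + a * b * (t * (Uₐ * U_b)) →
    c * (Wₐ * W_b) ≈ W_c * (b * Wₐ + a * W_b + a * b * t)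
  recip-addition {a} {b} {c} {t} {Uₐ} {U_b} {U_c} {Wₐ} {W_b} {W_c} UWₐ UW_b UW_c U-+ = begin
    c * (Wₐ * W_b)                                                          ≈⟨ *-identityʳ _ ⟨
    c * (Wₐ * W_b) * 1#                                                     ≈⟨ *-congˡ UW_c ⟨
    c * (Wₐ * W_b) * (U_c * W_c)                                            ≈⟨ solve 5 (λ c x y u w → c :* (x :* y) :* (u :* w) := w :* (x :* y) :* (c :* u)) refl c Wₐ W_b U_c W_c ⟩
    W_c * (Wₐ * W_b) * (c * U_c)                                            ≈⟨ *-congˡ U-+ ⟩
    W_c * (Wₐ * W_b) * (a * Uₐ + b * U_b + a * b * (t * (Uₐ * U_b)))        ≈⟨ solve 8 (λ w x y a u b v t → w :* (x :* y) :* (a :* u :+ b :* v :+ a :* b :* (t :* (u :* v))) := w :* (b :* x :* (v :* y) :+ a :* y :* (u :* x) :+ a :* b :* t :* ((u :* x) :* (v :* y)))) refl W_c Wₐ W_b a Uₐ b U_b t ⟩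
    W_c * (b * Wₐ * (U_b * W_b) + a * W_b * (Uₐ * Wₐ) + a * b * t * ((Uₐ * Wₐ) * (U_b * W_b)))
      ≈⟨ *-congˡ (+-cong (+-cong (drop UW_b) (drop UWₐ)) (drop (trans (*-cong UWₐ UW_b) (*-identityˡ 1#)))) ⟩
    W_c * (b * Wₐ + a * W_b + a * b * t)                                    ∎
    where
    drop : ∀ {x y} → y ≈ 1# → x * y ≈ x
    drop y≈1 = trans (*-congˡ y≈1) (*-identityʳ _)

  -- The two contributions h a b t add up to a b t, so the bracket b Wₐ + a W_b + a b t is b Gₐ + a
  -- G_b. The left side contributes the same bracket once more with the factor h c t, which
  -- completes W_c to G_c.
  coth-addition : ∀ {a b c h t Wₐ W_b W_c Gₐ G_b G_c} →
    h + h ≈ 1# →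
    c * (Wₐ * W_b) ≈ W_c * (b * Wₐ + a * W_b + a * b * t) →
    Gₐ ≈ Wₐ + h * (a * t) → G_b ≈ W_b + h * (b * t) → G_c ≈ W_c + h * (c * t) →
    c * (Gₐ * G_b + h * h * (a * b) * (t * t)) ≈ G_c * (b * Gₐ + a * G_b)
  coth-addition {a} {b} {c} {h} {t} {Wₐ} {W_b} {W_c} {Gₐ} {G_b} {G_c} h+h≈1 W-+ Gₐ≈ G_b≈ G_c≈ = begin
    c * (Gₐ * G_b + h * h * (a * b) * (t * t))
      ≈⟨ *-congˡ (+-congʳ (*-cong Gₐ≈ G_b≈)) ⟩
    c * ((Wₐ + h * (a * t)) * (W_b + h * (b * t)) + h * h * (a * b) * (t * t))
      ≈⟨ solve 7 (λ a b c h t x y → c :* ((x :+ h :* (a :* t)) :* (y :+ h :* (b :* t)) :+ h :* h :* (a :* b) :* (t :* t))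
           := c :* (x :* y) :+ h :* (c :* t) :* (b :* x :+ a :* y :+ a :* b :* t :* (h :+ h))) refl a b c h t Wₐ W_b ⟩
    c * (Wₐ * W_b) + h * (c * t) * (b * Wₐ + a * W_b + a * b * t * (h + h))
      ≈⟨ +-cong W-+ (*-congˡ (+-congˡ (trans (*-congˡ h+h≈1) (*-identityʳ _)))) ⟩
    W_c * (b * Wₐ + a * W_b + a * b * t) + h * (c * t) * (b * Wₐ + a * W_b + a * b * t)
      ≈⟨ distribʳ _ _ _ ⟨
    (W_c + h * (c * t)) * (b * Wₐ + a * W_b + a * b * t)
      ≈⟨ *-cong G_c≈ (+-congˡ (trans (*-congˡ h+h≈1) (*-identityʳ _))) ⟨
    G_c * (b * Wₐ + a * W_b + a * b * t * (h + h))
      ≈⟨ *-congˡ (solve 6 (λ a b h t x y → b :* x :+ a :* y :+ a :* b :* t :* (h :+ h) := b :* (x :+ h :* (a :* t)) :+ a :* (y :+ h :* (b :* t))) refl a b h t Wₐ W_b) ⟩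
    G_c * (b * (Wₐ + h * (a * t)) + a * (W_b + h * (b * t)))
      ≈⟨ *-congˡ (+-cong (*-congˡ Gₐ≈) (*-congˡ G_b≈)) ⟨
    G_c * (b * Gₐ + a * G_b)
      ∎

-- Integers and factorials in ℚ

ℚ-semiring : CommutativeSemiring _ _
ℚ-semiring = CommutativeRing.commutativeSemiring ℚₚ.+-*-commutativeRing

module ℚ[[t]] = SeriesSemiring ℚ-semiring
open ℚ[[t]] using (conv)

∑≡conv : ∀ n F → (∑[ k ≤ n ] F (toℕ k) (n ℕ.∸ toℕ k)) ≡ conv n F
∑≡conv zero    F = ℚₚ.+-identityʳ (F 0 0)
∑≡conv (suc n) F = ≡.cong (F 0 (suc n) ℚ.+_) (∑≡conv n (λ i j → F (suc i) j))

fromℤ : ℤ → ℚ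
fromℤ z = z ℚ./ 1

fromℕ : ℕ → ℚ
fromℕ n = fromℤ (+ n)

toℚᵘ-fromℤ : ∀ z → ℚ.toℚᵘ (fromℤ z) ℚᵘ.≃ ℚᵘ.mkℚᵘ z 0
toℚᵘ-fromℤ z = ℚₚ.toℚᵘ-fromℚᵘ (ℚᵘ.mkℚᵘ z 0)

fromℤ-+ : ∀ i j → fromℤ (i ℤ.+ j) ≡ fromℤ i ℚ.+ fromℤ j
fromℤ-+ i j = ℚₚ.toℚᵘ-injective (begin
  ℚ.toℚᵘ (fromℤ (i ℤ.+ j))                        ≈⟨ toℚᵘ-fromℤ (i ℤ.+ j) ⟩
  ℚᵘ.mkℚᵘ (i ℤ.+ j) 0                             ≈⟨ ℚᵘ.*≡* (≡.cong (ℤ._* + 1) (≡.sym (≡.cong₂ ℤ._+_ (ℤₚ.*-identityʳ i) (ℤₚ.*-identityʳ j)))) ⟩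
  ℚᵘ.mkℚᵘ i 0 ℚᵘ.+ ℚᵘ.mkℚᵘ j 0                    ≈⟨ ℚᵘₚ.+-cong (toℚᵘ-fromℤ i) (toℚᵘ-fromℤ j) ⟨
  ℚ.toℚᵘ (fromℤ i) ℚᵘ.+ ℚ.toℚᵘ (fromℤ j)          ≈⟨ ℚₚ.toℚᵘ-homo-+ (fromℤ i) (fromℤ j) ⟨
  ℚ.toℚᵘ (fromℤ i ℚ.+ fromℤ j)                    ∎)
  where open ℚᵘₚ.≃-Reasoning

fromℤ-* : ∀ i j → fromℤ (i ℤ.* j) ≡ fromℤ i ℚ.* fromℤ j
fromℤ-* i j = ℚₚ.toℚᵘ-injective (begin
  ℚ.toℚᵘ (fromℤ (i ℤ.* j))                        ≈⟨ toℚᵘ-fromℤ (i ℤ.* j) ⟩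
  ℚᵘ.mkℚᵘ i 0 ℚᵘ.* ℚᵘ.mkℚᵘ j 0                    ≈⟨ ℚᵘₚ.*-cong (toℚᵘ-fromℤ i) (toℚᵘ-fromℤ j) ⟨
  ℚ.toℚᵘ (fromℤ i) ℚᵘ.* ℚ.toℚᵘ (fromℤ j)          ≈⟨ ℚₚ.toℚᵘ-homo-* (fromℤ i) (fromℤ j) ⟨
  ℚ.toℚᵘ (fromℤ i ℚ.* fromℤ j)                    ∎)
  where open ℚᵘₚ.≃-Reasoning

fromℕ-* : ∀ m n → fromℕ (m ℕ.* n) ≡ fromℕ m ℚ.* fromℕ n
fromℕ-* m n = ≡.trans (≡.cong fromℤ (ℤₚ.pos-* m n)) (fromℤ-* (+ m) (+ n))

d*[i/d] : ∀ i d .{{_ : ℕ.NonZero d}} → fromℕ d ℚ.* (i ℚ./ d) ≡ fromℤ i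
d*[i/d] i d@(suc d-1) = ℚₚ.toℚᵘ-injective (begin
  ℚ.toℚᵘ (fromℕ d ℚ.* (i ℚ./ d))              ≈⟨ ℚₚ.toℚᵘ-homo-* (fromℕ d) (i ℚ./ d) ⟩
  ℚ.toℚᵘ (fromℕ d) ℚᵘ.* ℚ.toℚᵘ (i ℚ./ d)      ≈⟨ ℚᵘₚ.*-cong (toℚᵘ-fromℤ (+ d)) (ℚₚ.toℚᵘ-fromℚᵘ (ℚᵘ.mkℚᵘ i d-1)) ⟩
  ℚᵘ.mkℚᵘ (+ d) 0 ℚᵘ.* ℚᵘ.mkℚᵘ i d-1          ≈⟨ ℚᵘ.*≡* (≡.trans (ℤₚ.*-identityʳ _) (≡.trans (ℤₚ.*-comm (+ d) i) (≡.cong (λ e → i ℤ.* + e) (≡.sym (ℕₚ.*-identityˡ d))))) ⟩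
  ℚᵘ.mkℚᵘ i 0                                 ≈⟨ toℚᵘ-fromℤ i ⟨
  ℚ.toℚᵘ (fromℤ i)                            ∎)
  where open ℚᵘₚ.≃-Reasoning

n!*1/n! : ∀ n → fromℕ (n !) ℚ.* 1/ n ! ≡ 1ℚ
n!*1/n! n = d*[i/d] (+ 1) (n !) {{n ℕₚ.!≢0}}

[1+n]*1/[1+n]! : ∀ n → fromℕ (suc n) ℚ.* 1/ suc n ! ≡ 1/ n !
[1+n]*1/[1+n]! n = begin
  s ℚ.* y                     ≡⟨ ℚₚ.*-identityʳ _ ⟨
  s ℚ.* y ℚ.* 1ℚ              ≡⟨ ≡.cong (s ℚ.* y ℚ.*_) (n!*1/n! n) ⟨
  s ℚ.* y ℚ.* (f ℚ.* x)       ≡⟨ solve 4 (λ s y f x → s :* y :* (f :* x) := s :* f :* y :* x) ≡.refl s y f x ⟩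
  s ℚ.* f ℚ.* y ℚ.* x         ≡⟨ ≡.cong (λ z → z ℚ.* y ℚ.* x) (≡.sym (fromℕ-* (suc n) (n !))) ⟩
  fromℕ (suc n !) ℚ.* y ℚ.* x ≡⟨ ≡.cong (ℚ._* x) (n!*1/n! (suc n)) ⟩
  1ℚ ℚ.* x                    ≡⟨ ℚₚ.*-identityˡ x ⟩
  x                           ∎
  where
  open ≡.≡-Reasoning
  open +-*-Solver
  s = fromℕ (suc n)
  f = fromℕ (n !)
  x = 1/ n !
  y = 1/ suc n !

-- These are the numbers Bₖ / k!: `B k` unfolds to `k !` times `bern k`.
bern : PowerSeries
bern = recip (exp-1 /t)

-- The coefficients of (t / 2) coth (t / 2) = t / (eᵗ - 1) + t / 2.
γ : PowerSeries
γ n = bern n ℚ.+ ½ ℚ.* t n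

-- Exponential and coth series of x t, for x in a semiring with rational scalars

module ScaledSeries {c ℓ} (R : CommutativeSemiring c ℓ) (ι : ℚ → CommutativeSemiring.Carrier R)
  (ι-+ : ∀ p q → CommutativeSemiring._≈_ R (ι (p ℚ.+ q)) (CommutativeSemiring._+_ R (ι p) (ι q)))
  (ι-* : ∀ p q → CommutativeSemiring._≈_ R (ι (p ℚ.* q)) (CommutativeSemiring._*_ R (ι p) (ι q)))
  (ι-0 : CommutativeSemiring._≈_ R (ι 0ℚ) (CommutativeSemiring.0# R))
  (ι-1 : CommutativeSemiring._≈_ R (ι 1ℚ) (CommutativeSemiring.1# R)) where

  open CommutativeSemiring R hiding (zero)
  open import Algebra.Properties.Semiring.Exp semiring using (_^_; ^-homo-*)
  open import Algebra.Properties.CommutativeSemigroup *-commutativeSemigroup using (interchange; x∙yz≈y∙xz)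
  open SeriesSemiring R renaming (conv to convᴿ)
  open import Relation.Binary.Reasoning.Setoid setoid
  module S = CommutativeSemiring seriesSemiring

  ι-conv : ∀ n F → ι (conv n F) ≈ convᴿ n (λ i j → ι (F i j))
  ι-conv zero    F = refl
  ι-conv (suc n) F = trans (ι-+ _ _) (+-congˡ (ι-conv n _))

  -- f(x t)
  scale : PowerSeries → Carrier → Series
  scale f x n = ι (f n) * x ^ n

  scale-⊗ : ∀ f g x n → scale (f ℚ[[t]].⊗ g) x n ≈ (scale f x ⊗ scale g x) n
  scale-⊗ f g x n = begin
    ι (conv n (λ i j → f i ℚ.* g j)) * x ^ n             ≈⟨ *-congʳ (ι-conv n _) ⟩
    convᴿ n (λ i j → ι (f i ℚ.* g j)) * x ^ n            ≈⟨ conv-*ʳ n _ _ ⟩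
    convᴿ n (λ i j → ι (f i ℚ.* g j) * x ^ n)            ≈⟨ conv-cong n term ⟩
    convᴿ n (λ i j → ι (f i) * x ^ i * (ι (g j) * x ^ j)) ∎
    where
    term : ∀ i j → i ℕ.+ j ≡ n → ι (f i ℚ.* g j) * x ^ n ≈ ι (f i) * x ^ i * (ι (g j) * x ^ j)
    term i j ≡.refl = begin
      ι (f i ℚ.* g j) * x ^ (i ℕ.+ j)          ≈⟨ *-cong (ι-* _ _) (^-homo-* x i j) ⟩
      ι (f i) * ι (g j) * (x ^ i * x ^ j)      ≈⟨ interchange _ _ _ _ ⟩
      ι (f i) * x ^ i * (ι (g j) * x ^ j)      ∎

  ι-cancel : ∀ {p q r} → p ℚ.* q ≡ r → ι p * ι q ≈ ι r
  ι-cancel {p} {q} eq = trans (sym (ι-* p q)) (reflexive (≡.cong ι eq))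

  exp : Carrier → Series
  exp = scale 1/_!

  exp-suc : ∀ x n → ι (fromℕ (suc n)) * exp x (suc n) ≈ x * exp x n
  exp-suc x n = begin
    ι (fromℕ (suc n)) * (ι (1/ suc n !) * (x * x ^ n))   ≈⟨ *-assoc _ _ _ ⟨
    ι (fromℕ (suc n)) * ι (1/ suc n !) * (x * x ^ n)     ≈⟨ *-congʳ (ι-cancel ([1+n]*1/[1+n]! n)) ⟩
    ι (1/ n !) * (x * x ^ n)                             ≈⟨ x∙yz≈y∙xz _ _ _ ⟩
    x * exp x n                                          ∎

  -- This is the product rule for the derivative of eᵃᵗ eᵇᵗ, read off coefficientwise: the weight
  -- `suc n` splits as i + j, and each part lowers the index of one exponential.
  exp-⊗-suc : ∀ a b n → ι (fromℕ (suc n)) * (exp a ⊗ exp b) (suc n) ≈ (a + b) * (exp a ⊗ exp b) n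
  exp-⊗-suc a b n = begin
    ι (fromℕ (suc n)) * convᴿ (suc n) F
      ≈⟨ conv-*ˡ (suc n) _ F ⟩
    convᴿ (suc n) (λ i j → ι (fromℕ (suc n)) * F i j)
      ≈⟨ conv-cong (suc n) split ⟩
    convᴿ (suc n) (λ i j → ι (fromℕ i) * F i j + ι (fromℕ j) * F i j)
      ≈⟨ conv-+ (suc n) (λ i j → ι (fromℕ i) * F i j) (λ i j → ι (fromℕ j) * F i j) ⟩
    convᴿ (suc n) (λ i j → ι (fromℕ i) * F i j) + convᴿ (suc n) (λ i j → ι (fromℕ j) * F i j)
      ≈⟨ +-cong left right ⟩
    a * convᴿ n F + b * convᴿ n F
      ≈⟨ distribʳ _ _ _ ⟨
    (a + b) * convᴿ n F
      ∎
    where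
    F : ℕ → ℕ → Carrier
    F i j = exp a i * exp b j
    split : ∀ i j → i ℕ.+ j ≡ suc n → ι (fromℕ (suc n)) * F i j ≈ ι (fromℕ i) * F i j + ι (fromℕ j) * F i j
    split i j eq = trans (*-congʳ (trans (reflexive (≡.cong ι (≡.trans (≡.cong fromℕ (≡.sym eq)) (fromℤ-+ (+ i) (+ j))))) (ι-+ _ _))) (distribʳ _ _ _)
    vanish : ∀ x → ι (fromℕ 0) * x ≈ 0#
    vanish x = trans (*-congʳ ι-0) (zeroˡ x)
    left : convᴿ (suc n) (λ i j → ι (fromℕ i) * F i j) ≈ a * convᴿ n F
    left = begin
      _ + convᴿ n (λ i j → ι (fromℕ (suc i)) * F (suc i) j)  ≈⟨ trans (+-congʳ (vanish _)) (+-identityˡ _) ⟩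
      convᴿ n (λ i j → ι (fromℕ (suc i)) * F (suc i) j)      ≈⟨ conv-cong′ n (λ i j → trans (sym (*-assoc _ _ _)) (trans (*-congʳ (exp-suc a i)) (*-assoc _ _ _))) ⟩
      convᴿ n (λ i j → a * F i j)                            ≈⟨ conv-*ˡ n a F ⟨
      a * convᴿ n F                                          ∎
    right : convᴿ (suc n) (λ i j → ι (fromℕ j) * F i j) ≈ b * convᴿ n F
    right = begin
      convᴿ (suc n) (λ i j → ι (fromℕ j) * F i j)            ≈⟨ conv-last n (λ i j → ι (fromℕ j) * F i j) ⟩
      convᴿ n (λ i j → ι (fromℕ (suc j)) * F i (suc j)) + _  ≈⟨ trans (+-congˡ (vanish _)) (+-identityʳ _) ⟩
      convᴿ n (λ i j → ι (fromℕ (suc j)) * F i (suc j))      ≈⟨ conv-cong′ n (λ i j → trans (x∙yz≈y∙xz _ _ _) (trans (*-congˡ (exp-suc b j)) (x∙yz≈y∙xz _ _ _))) ⟩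
      convᴿ n (λ i j → b * F i j)                            ≈⟨ conv-*ˡ n b F ⟨
      b * convᴿ n F                                          ∎

  -- Both sides have constant term 1 and obey the same first-order recurrence, by `exp-⊗-suc` and
  -- `exp-suc`. The recurrence determines them because `suc n` is invertible in ℚ.
  exp-⊗ : ∀ a b n → (exp a ⊗ exp b) n ≈ exp (a + b) n
  exp-⊗ a b zero    = trans (interchange _ _ _ _) (*-cong (trans (*-cong ι-1 ι-1) (trans (*-identityˡ _) (sym ι-1))) (*-identityˡ _))
  exp-⊗ a b (suc n) = begin
    (exp a ⊗ exp b) (suc n)          ≈⟨ cancel _ ⟨
    ι (+ 1 ℚ./ suc n) * (ι (fromℕ (suc n)) * (exp a ⊗ exp b) (suc n)) ≈⟨ *-congˡ (exp-⊗-suc a b n) ⟩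
    ι (+ 1 ℚ./ suc n) * ((a + b) * (exp a ⊗ exp b) n)                 ≈⟨ *-congˡ (*-congˡ (exp-⊗ a b n)) ⟩
    ι (+ 1 ℚ./ suc n) * ((a + b) * exp (a + b) n)                     ≈⟨ *-congˡ (exp-suc (a + b) n) ⟨
    ι (+ 1 ℚ./ suc n) * (ι (fromℕ (suc n)) * exp (a + b) (suc n))     ≈⟨ cancel _ ⟩
    exp (a + b) (suc n)              ∎
    where
    cancel : ∀ x → ι (+ 1 ℚ./ suc n) * (ι (fromℕ (suc n)) * x) ≈ x
    cancel x = trans (sym (*-assoc _ _ _)) (trans (*-congʳ (trans (ι-cancel (≡.trans (ℚₚ.*-comm (+ 1 ℚ./ suc n) _) (d*[i/d] (+ 1) (suc n)))) ι-1)) (*-identityˡ x))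

  E₁ U W G : Carrier → Series
  E₁ = scale exp-1
  U  = scale (exp-1 /t)
  W  = scale bern
  G  = scale γ

  -- As an element of the semiring, t can be moved past other factors by the solver; the index shift
  -- `t·_` is the form in which it can be cancelled.
  𝐭 : Series
  𝐭 = t· const 1#

  𝐭-⊗ : ∀ f → (𝐭 ⊗ f) S.≈ (t· f)
  𝐭-⊗ f zero    = t·-⊗ (const 1#) f zero
  𝐭-⊗ f (suc n) = trans (t·-⊗ (const 1#) f (suc n)) (S.*-identityˡ f n)

  exp≈1+E₁ : ∀ x → exp x S.≈ (const 1# S.+ E₁ x)
  exp≈1+E₁ x zero    = trans (*-identityʳ _) (trans ι-1 (sym (trans (+-congˡ (trans (*-congʳ ι-0) (zeroˡ _))) (+-identityʳ _))))
  exp≈1+E₁ x (suc n) = sym (+-identityˡ _)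

  E₁≈txU : ∀ x → E₁ x S.≈ (t· (const x ⊗ U x))
  E₁≈txU x zero    = trans (*-congʳ ι-0) (zeroˡ _)
  E₁≈txU x (suc n) = trans (x∙yz≈y∙xz _ _ _) (sym (const-⊗ x (U x) n))

  module _ (a b : Carrier) where
    open import Algebra.Solver.Ring.NaturalCoefficients.Default seriesSemiring using (solve; _:*_; _:=_)

    E₁-+ : ∀ n → E₁ (a + b) (suc n) ≈ (E₁ a S.+ E₁ b S.+ E₁ a ⊗ E₁ b) (suc n)
    E₁-+ n = begin
      E₁ (a + b) (suc n)                                           ≈⟨ exp-⊗ a b (suc n) ⟨
      (exp a ⊗ exp b) (suc n)                                      ≈⟨ S.*-cong (exp≈1+E₁ a) (exp≈1+E₁ b) (suc n) ⟩
      ((const 1# S.+ E₁ a) ⊗ (const 1# S.+ E₁ b)) (suc n)          ≈⟨ CothAddition.[1+x]*[1+y] seriesSemiring (E₁ a) (E₁ b) (suc n) ⟩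
      (const 1# S.+ (E₁ a S.+ E₁ b S.+ E₁ a ⊗ E₁ b)) (suc n)       ≈⟨ +-identityˡ _ ⟩
      (E₁ a S.+ E₁ b S.+ E₁ a ⊗ E₁ b) (suc n)                      ∎

    E₁a⊗E₁b : ∀ n → (E₁ a ⊗ E₁ b) (suc n) ≈ (const a ⊗ const b ⊗ (𝐭 ⊗ (U a ⊗ U b))) n
    E₁a⊗E₁b n = begin
      -- Of the two factors t, the first is kept as an index shift and absorbed by `suc n`, the
      -- second becomes the element `𝐭`.
      (E₁ a ⊗ E₁ b) (suc n)                             ≈⟨ S.*-cong (E₁≈txU a) (S.trans (E₁≈txU b) (S.sym (𝐭-⊗ _))) (suc n) ⟩
      (t· (const a ⊗ U a) ⊗ (𝐭 ⊗ (const b ⊗ U b))) (suc n) ≈⟨ t·-⊗ (const a ⊗ U a) (𝐭 ⊗ (const b ⊗ U b)) (suc n) ⟩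
      (const a ⊗ U a ⊗ (𝐭 ⊗ (const b ⊗ U b))) n         ≈⟨ solve 5 (λ x u t y v → x :* u :* (t :* (y :* v)) := x :* y :* (t :* (u :* v))) S.refl (const a) (U a) 𝐭 (const b) (U b) n ⟩
      (const a ⊗ const b ⊗ (𝐭 ⊗ (U a ⊗ U b))) n         ∎

    -- Coefficient n here is coefficient `suc n` of the expansion of e⁽ᵃ⁺ᵇ⁾ᵗ - 1, so t is divided
    -- out by comparing shifted indices.
    U-+ : (const (a + b) ⊗ U (a + b)) S.≈ (const a ⊗ U a S.+ const b ⊗ U b S.+ const a ⊗ const b ⊗ (𝐭 ⊗ (U a ⊗ U b)))
    U-+ n = begin
      (const (a + b) ⊗ U (a + b)) n                     ≈⟨ E₁≈txU (a + b) (suc n) ⟨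
      E₁ (a + b) (suc n)                                ≈⟨ E₁-+ n ⟩
      E₁ a (suc n) + E₁ b (suc n) + (E₁ a ⊗ E₁ b) (suc n) ≈⟨ +-cong (+-cong (E₁≈txU a (suc n)) (E₁≈txU b (suc n))) (E₁a⊗E₁b n) ⟩
      _                                                 ∎

  U⊗W≈1 : ∀ x → (U x ⊗ W x) S.≈ S.1#
  U⊗W≈1 x n = begin
    (U x ⊗ W x) n                          ≈⟨ scale-⊗ (exp-1 /t) bern x n ⟨
    scale ((exp-1 /t) ℚ[[t]].⊗ bern) x n   ≡⟨ ≡.cong (λ q → ι q * x ^ n) (≡.trans (≡.sym (∑≡conv n _)) (⊛-recip (exp-1 /t) ≡.refl n)) ⟩
    scale 𝟙 x n                            ≈⟨ scale-𝟙 n ⟩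
    const 1# n                             ∎
    where
    scale-𝟙 : ∀ n → scale 𝟙 x n ≈ const 1# n
    scale-𝟙 zero    = trans (*-identityʳ _) ι-1
    scale-𝟙 (suc n) = trans (*-congʳ ι-0) (zeroˡ _)

  const-+ : ∀ x y → const (x + y) S.≈ (const x S.+ const y)
  const-+ x y zero    = refl
  const-+ x y (suc n) = sym (+-identityʳ _)

  const-* : ∀ x y → const (x * y) S.≈ (const x ⊗ const y)
  const-* x y zero    = refl
  const-* x y (suc n) = sym (trans (const-⊗ x (const y) (suc n)) (zeroʳ x))

  h : Series
  h = const (ι ½)

  h+h≈1 : (h S.+ h) S.≈ S.1#
  h+h≈1 = S.trans (S.sym (const-+ _ _)) eq
    where
    eq : const (ι ½ + ι ½) S.≈ S.1#
    eq zero    = trans (sym (ι-+ ½ ½)) ι-1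
    eq (suc n) = refl

  G≈W+½xt : ∀ x → G x S.≈ (W x S.+ h ⊗ (const x ⊗ 𝐭))
  G≈W+½xt x n = begin
    ι (bern n ℚ.+ ½ ℚ.* t n) * x ^ n                  ≈⟨ *-congʳ (ι-+ _ _) ⟩
    (ι (bern n) + ι (½ ℚ.* t n)) * x ^ n              ≈⟨ distribʳ _ _ _ ⟩
    W x n + ι (½ ℚ.* t n) * x ^ n                     ≈⟨ +-congˡ (trans (*-congʳ (ι-* _ _)) (*-assoc _ _ _)) ⟩
    W x n + ι ½ * (ι (t n) * x ^ n)                   ≈⟨ +-congˡ (*-congˡ (linear n)) ⟩
    W x n + ι ½ * (const x ⊗ 𝐭) n                     ≈⟨ +-congˡ (const-⊗ (ι ½) (const x ⊗ 𝐭) n) ⟨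
    W x n + (h ⊗ (const x ⊗ 𝐭)) n                     ∎
    where
    linear : ∀ n → ι (t n) * x ^ n ≈ (const x ⊗ 𝐭) n
    linear zero          = trans (*-congʳ ι-0) (trans (zeroˡ _) (sym (zeroʳ _)))
    linear (suc zero)    = trans (*-cong ι-1 (*-identityʳ x)) (trans (*-comm _ _) (sym (const-⊗ x 𝐭 1)))
    linear (suc (suc n)) = trans (*-congʳ ι-0) (trans (zeroˡ _) (sym (trans (const-⊗ x 𝐭 (suc (suc n))) (zeroʳ x))))

  -- Single coefficients are compared because the degree in t records the degree in a and b, on
  -- which the evaluation of operators depends. The instance over operators serves the theorem, the
  -- instance over ℚ the parity of `γ`.
  coth-addition-coeff : ∀ a b n →
    (a + b) * (convᴿ n (λ i j → G a i * G b j) + (t· t· const (ι ½ * ι ½ * (a * b))) n)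
      ≈ convᴿ n (λ k j → G (a + b) k * (b * G a j + a * G b j))
  coth-addition-coeff a b n = begin
    (a + b) * (convᴿ n (λ i j → G a i * G b j) + (t· t· const (ι ½ * ι ½ * (a * b))) n)
      ≈⟨ *-congˡ (+-congˡ (quadratic n)) ⟩
    (a + b) * (G a ⊗ G b S.+ h ⊗ h ⊗ (const a ⊗ const b) ⊗ (𝐭 ⊗ 𝐭)) n
      ≈⟨ const-⊗ (a + b) _ n ⟨
    (const (a + b) ⊗ (G a ⊗ G b S.+ h ⊗ h ⊗ (const a ⊗ const b) ⊗ (𝐭 ⊗ 𝐭))) n
      ≈⟨ coth-addition h+h≈1 (recip-addition (U⊗W≈1 a) (U⊗W≈1 b) (U⊗W≈1 (a + b)) (U-+ a b)) (G≈W+½xt a) (G≈W+½xt b) (G≈W+½xt (a + b)) n ⟩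
    (G (a + b) ⊗ (const b ⊗ G a S.+ const a ⊗ G b)) n
      ≈⟨ conv-cong′ n (λ k j → *-congˡ (+-cong (const-⊗ b (G a) j) (const-⊗ a (G b) j))) ⟩
    convᴿ n (λ k j → G (a + b) k * (b * G a j + a * G b j))
      ∎
    where
    open CothAddition seriesSemiring
    t·-cong : ∀ {f g} → f S.≈ g → (t· f) S.≈ (t· g)
    t·-cong f≈g zero    = refl
    t·-cong f≈g (suc n) = f≈g n
    quadratic : (t· t· const (ι ½ * ι ½ * (a * b))) S.≈ (h ⊗ h ⊗ (const a ⊗ const b) ⊗ (𝐭 ⊗ 𝐭))
    quadratic = S.sym (S.trans (S.*-comm (h ⊗ h ⊗ (const a ⊗ const b)) (𝐭 ⊗ 𝐭)) (S.trans (S.*-assoc 𝐭 𝐭 _)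
      (S.trans (𝐭-⊗ _) (t·-cong (S.trans (𝐭-⊗ _) (t·-cong (S.sym
        (S.trans (const-* _ _) (S.*-cong (const-* _ _) (const-* _ _))))))))))

-- Rising factorials

open import Data.Rational.Base using (_+_; _*_; -_)
open ℚ[[t]] using (conv-cong; conv-cong′; conv-0; conv-+; conv-*ˡ; conv-flip)
open ≡.≡-Reasoning
open +-*-Solver using (solve; _:+_; _:*_; _:=_; con; :-_)
private module ℤ+* = ℤSolver.+-*-Solver

fromℕ-suc : ∀ n → fromℕ (suc n) ≡ 1ℚ + fromℕ n
fromℕ-suc n = fromℤ-+ (+ 1) (+ n)

rise : ℚ → ℕ → ℚ
rise x zero    = 1ℚ
rise x (suc k) = x * rise (x + 1ℚ) k

-- These are two ways to split x⁽ᵏ⁺¹⁾: by its first factor and by its last.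
rise-suc : ∀ x k → x * rise (x + 1ℚ) k ≡ (x + fromℕ k) * rise x k
rise-suc x zero    = ≡.cong (_* 1ℚ) (≡.sym (ℚₚ.+-identityʳ x))
rise-suc x (suc k) = begin
  x * ((x + 1ℚ) * rise (x + 1ℚ + 1ℚ) k)            ≡⟨ ≡.cong (x *_) (rise-suc (x + 1ℚ) k) ⟩
  x * ((x + 1ℚ + fromℕ k) * rise (x + 1ℚ) k)       ≡⟨ solve 3 (λ x k r → x :* ((x :+ con 1ℚ :+ k) :* r) := (x :+ (con 1ℚ :+ k)) :* (x :* r)) ≡.refl x (fromℕ k) (rise (x + 1ℚ) k) ⟩
  (x + (1ℚ + fromℕ k)) * (x * rise (x + 1ℚ) k)     ≡⟨ ≡.cong (λ z → (x + z) * (x * rise (x + 1ℚ) k)) (fromℕ-suc k) ⟨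
  (x + fromℕ (suc k)) * (x * rise (x + 1ℚ) k)      ∎

-- Operators whose powers produce rising factorials

module Operators where

  -- Syntax for polynomials in 𝕏 and 𝕐, to be compared by their action on functions of
  -- (x, y): all operators of this form commute, whereas arbitrary operators do not.
  infixl 6 _⊞_
  infixl 7 _⊠_
  data Op : Set where
    scalar  : ℚ → Op
    𝕏 𝕐     : Op
    _⊞_ _⊠_ : Op → Op → Op

  Fun : Set
  Fun = ℚ → ℚ → ℚ

  ⟦_⟧ : Op → Fun → Fun
  ⟦ scalar q ⟧ φ x y = q * φ x y
  ⟦ 𝕏 ⟧        φ x y = x * φ (x + 1ℚ) y
  ⟦ 𝕐 ⟧        φ x y = y * φ x (y + 1ℚ)
  ⟦ e ⊞ f ⟧    φ x y = ⟦ e ⟧ φ x y + ⟦ f ⟧ φ x y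
  ⟦ e ⊠ f ⟧    φ     = ⟦ e ⟧ (⟦ f ⟧ φ)

  -- Functions are compared pointwise, so rewriting underneath an operator needs this congruence.
  ⟦_⟧-cong : ∀ e {φ ψ} → (∀ x y → φ x y ≡ ψ x y) → ∀ x y → ⟦ e ⟧ φ x y ≡ ⟦ e ⟧ ψ x y
  ⟦ scalar q ⟧-cong eq x y = ≡.cong (q *_) (eq x y)
  ⟦ 𝕏 ⟧-cong        eq x y = ≡.cong (x *_) (eq (x + 1ℚ) y)
  ⟦ 𝕐 ⟧-cong        eq x y = ≡.cong (y *_) (eq x (y + 1ℚ))
  ⟦ e ⊞ f ⟧-cong    eq x y = ≡.cong₂ _+_ (⟦ e ⟧-cong eq x y) (⟦ f ⟧-cong eq x y)
  ⟦ e ⊠ f ⟧-cong    eq     = ⟦ e ⟧-cong (⟦ f ⟧-cong eq)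

  swap : ∀ p q r → p * (q * r) ≡ q * (p * r)
  swap = solve 3 (λ p q r → p :* (q :* r) := q :* (p :* r)) ≡.refl

  ⟦_⟧-+ : ∀ e φ ψ x y → ⟦ e ⟧ (λ u v → φ u v + ψ u v) x y ≡ ⟦ e ⟧ φ x y + ⟦ e ⟧ ψ x y
  ⟦ scalar q ⟧-+ φ ψ x y = ℚₚ.*-distribˡ-+ q (φ x y) (ψ x y)
  ⟦ 𝕏 ⟧-+        φ ψ x y = ℚₚ.*-distribˡ-+ x (φ (x + 1ℚ) y) (ψ (x + 1ℚ) y)
  ⟦ 𝕐 ⟧-+        φ ψ x y = ℚₚ.*-distribˡ-+ y (φ x (y + 1ℚ)) (ψ x (y + 1ℚ))
  ⟦ e ⊞ f ⟧-+    φ ψ x y = ≡.trans (≡.cong₂ _+_ (⟦ e ⟧-+ φ ψ x y) (⟦ f ⟧-+ φ ψ x y))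
    (solve 4 (λ p q r s → p :+ q :+ (r :+ s) := p :+ r :+ (q :+ s)) ≡.refl
      (⟦ e ⟧ φ x y) (⟦ e ⟧ ψ x y) (⟦ f ⟧ φ x y) (⟦ f ⟧ ψ x y))
  ⟦ e ⊠ f ⟧-+    φ ψ x y = ≡.trans (⟦ e ⟧-cong (⟦ f ⟧-+ φ ψ) x y) (⟦ e ⟧-+ (⟦ f ⟧ φ) (⟦ f ⟧ ψ) x y)

  ⟦_⟧-* : ∀ e q φ x y → ⟦ e ⟧ (λ u v → q * φ u v) x y ≡ q * ⟦ e ⟧ φ x y
  ⟦ scalar p ⟧-* q φ x y = swap p q (φ x y)
  ⟦ 𝕏 ⟧-*        q φ x y = swap x q (φ (x + 1ℚ) y)
  ⟦ 𝕐 ⟧-*        q φ x y = swap y q (φ x (y + 1ℚ))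
  ⟦ e ⊞ f ⟧-*    q φ x y = ≡.trans (≡.cong₂ _+_ (⟦ e ⟧-* q φ x y) (⟦ f ⟧-* q φ x y)) (≡.sym (ℚₚ.*-distribˡ-+ q (⟦ e ⟧ φ x y) (⟦ f ⟧ φ x y)))
  ⟦ e ⊠ f ⟧-*    q φ x y = ≡.trans (⟦ e ⟧-cong (⟦ f ⟧-* q φ) x y) (⟦ e ⟧-* q (⟦ f ⟧ φ) x y)

  𝕏-comm : ∀ f φ x y → ⟦ 𝕏 ⟧ (⟦ f ⟧ φ) x y ≡ ⟦ f ⟧ (⟦ 𝕏 ⟧ φ) x y
  𝕏-comm (scalar q) φ x y = swap x q (φ (x + 1ℚ) y)
  𝕏-comm 𝕏          φ x y = ≡.refl
  𝕏-comm 𝕐          φ x y = swap x y (φ (x + 1ℚ) (y + 1ℚ))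
  𝕏-comm (f ⊞ g)    φ x y = ≡.trans (ℚₚ.*-distribˡ-+ x (⟦ f ⟧ φ (x + 1ℚ) y) (⟦ g ⟧ φ (x + 1ℚ) y)) (≡.cong₂ _+_ (𝕏-comm f φ x y) (𝕏-comm g φ x y))
  𝕏-comm (f ⊠ g)    φ x y = ≡.trans (𝕏-comm f (⟦ g ⟧ φ) x y) (⟦ f ⟧-cong (𝕏-comm g φ) x y)

  𝕐-comm : ∀ f φ x y → ⟦ 𝕐 ⟧ (⟦ f ⟧ φ) x y ≡ ⟦ f ⟧ (⟦ 𝕐 ⟧ φ) x y
  𝕐-comm (scalar q) φ x y = swap y q (φ x (y + 1ℚ))
  𝕐-comm 𝕏          φ x y = swap y x (φ (x + 1ℚ) (y + 1ℚ))
  𝕐-comm 𝕐          φ x y = ≡.refl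
  𝕐-comm (f ⊞ g)    φ x y = ≡.trans (ℚₚ.*-distribˡ-+ y (⟦ f ⟧ φ x (y + 1ℚ)) (⟦ g ⟧ φ x (y + 1ℚ))) (≡.cong₂ _+_ (𝕐-comm f φ x y) (𝕐-comm g φ x y))
  𝕐-comm (f ⊠ g)    φ x y = ≡.trans (𝕐-comm f (⟦ g ⟧ φ) x y) (⟦ f ⟧-cong (𝕐-comm g φ) x y)

  -- Scalars pass through `f` because `f` is linear, sums because it is additive. The generators
  -- commute with each other since each shifts its own variable only.
  ⊠-comm : ∀ e f φ x y → ⟦ e ⟧ (⟦ f ⟧ φ) x y ≡ ⟦ f ⟧ (⟦ e ⟧ φ) x y
  ⊠-comm (scalar q) f φ x y = ≡.sym (⟦ f ⟧-* q φ x y)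
  ⊠-comm 𝕏          f φ x y = 𝕏-comm f φ x y
  ⊠-comm 𝕐          f φ x y = 𝕐-comm f φ x y
  ⊠-comm (e ⊞ g)    f φ x y = ≡.trans (≡.cong₂ _+_ (⊠-comm e f φ x y) (⊠-comm g f φ x y)) (≡.sym (⟦ f ⟧-+ (⟦ e ⟧ φ) (⟦ g ⟧ φ) x y))
  ⊠-comm (e ⊠ g)    f φ x y = ≡.trans (⟦ e ⟧-cong (⊠-comm g f φ) x y) (⊠-comm e f (⟦ g ⟧ φ) x y)

  infix 4 _≃_
  _≃_ : Op → Op → Set
  e ≃ f = ∀ φ x y → ⟦ e ⟧ φ x y ≡ ⟦ f ⟧ φ x y

  operatorSemiring : CommutativeSemiring _ _
  operatorSemiring = record
    { Carrier = Op
    ; _≈_ = _≃_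
    ; _+_ = _⊞_
    ; _*_ = _⊠_
    ; 0# = scalar 0ℚ
    ; 1# = scalar 1ℚ
    ; isCommutativeSemiring = isCommutativeSemiringˡ (record
      { +-isCommutativeMonoid = record
        { isMonoid = record
          { isSemigroup = record
            { isMagma = record
              { isEquivalence = isEquivalence
              ; ∙-cong = λ p q φ x y → ≡.cong₂ _+_ (p φ x y) (q φ x y)
              }
            ; assoc = λ e f g φ x y → ℚₚ.+-assoc (⟦ e ⟧ φ x y) (⟦ f ⟧ φ x y) (⟦ g ⟧ φ x y)
            }
          ; identity = (λ e φ x y → ≡.trans (≡.cong (_+ ⟦ e ⟧ φ x y) (ℚₚ.*-zeroˡ (φ x y))) (ℚₚ.+-identityˡ _))
                     , (λ e φ x y → ≡.trans (≡.cong (λ z → ⟦ e ⟧ φ x y + z) (ℚₚ.*-zeroˡ (φ x y))) (ℚₚ.+-identityʳ _))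
          }
        ; comm = λ e f φ x y → ℚₚ.+-comm (⟦ e ⟧ φ x y) (⟦ f ⟧ φ x y)
        }
      ; *-isCommutativeMonoid = record
        { isMonoid = record
          { isSemigroup = record
            { isMagma = record
              { isEquivalence = isEquivalence
              ; ∙-cong = λ {e} {f} {g} {h} p q φ x y → ≡.trans (⟦ e ⟧-cong (q φ) x y) (p (⟦ h ⟧ φ) x y)
              }
            ; assoc = λ _ _ _ _ _ _ → ≡.refl
            }
          ; identity = (λ e φ x y → ℚₚ.*-identityˡ _)
                     , (λ e φ x y → ⟦ e ⟧-cong (λ u v → ℚₚ.*-identityˡ (φ u v)) x y)
          }
        ; comm = ⊠-comm
        }
      ; distribʳ = λ _ _ _ _ _ _ → ≡.refl
      ; zeroˡ = λ e φ x y → ≡.trans (ℚₚ.*-zeroˡ (⟦ e ⟧ φ x y)) (≡.sym (ℚₚ.*-zeroˡ (φ x y)))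
      })
    }
    where
    isEquivalence : IsEquivalence _≃_
    isEquivalence = record
      { refl  = λ _ _ _ → ≡.refl
      ; sym   = λ p φ x y → ≡.sym (p φ x y)
      ; trans = λ p q φ x y → ≡.trans (p φ x y) (q φ x y)
      }

  module Op[[t]] = SeriesSemiring operatorSemiring
  module Scaled = ScaledSeries operatorSemiring scalar
    (λ p q φ x y → ℚₚ.*-distribʳ-+ (φ x y) p q)
    (λ p q φ x y → ℚₚ.*-assoc p q (φ x y))
    (λ _ _ _ → ≡.refl) (λ _ _ _ → ≡.refl)
  open import Algebra.Properties.Semiring.Exp (CommutativeSemiring.semiring operatorSemiring) using (_^_)
  open Scaled using (G; coth-addition-coeff)
  open Op[[t]] using (t·_; const)

  ⟦conv⟧ : ∀ n F φ x y → ⟦ Op[[t]].conv n F ⟧ φ x y ≡ conv n (λ i j → ⟦ F i j ⟧ φ x y)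
  ⟦conv⟧ zero    F φ x y = ≡.refl
  ⟦conv⟧ (suc n) F φ x y = ≡.cong (λ z → ⟦ F 0 (suc n) ⟧ φ x y + z) (⟦conv⟧ n _ φ x y)

  ⟦𝕏^_⟧ : ∀ i (ψ : ℚ → ℚ) x y → ⟦ 𝕏 ^ i ⟧ (λ _ v → ψ v) x y ≡ rise x i * ψ y
  ⟦𝕏^ zero ⟧  ψ x y = ≡.refl
  ⟦𝕏^ suc i ⟧ ψ x y = ≡.trans (≡.cong (x *_) (⟦𝕏^ i ⟧ ψ (x + 1ℚ) y)) (≡.sym (ℚₚ.*-assoc x _ (ψ y)))

  ⟦𝕐^_⟧ : ∀ j x y → ⟦ 𝕐 ^ j ⟧ (λ _ _ → 1ℚ) x y ≡ rise y j
  ⟦𝕐^ zero ⟧  x y = ≡.refl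
  ⟦𝕐^ suc j ⟧ x y = ≡.cong (y *_) (⟦𝕐^ j ⟧ x (y + 1ℚ))

  -- The functions x⁽ⁱ⁾ y⁽ʲ⁾ with i + j = d have this property, and so do their combinations: they
  -- are the images of forms of degree d.
  Homogeneous : ℕ → Fun → Set
  Homogeneous d φ = ∀ x y → ⟦ 𝕏 ⊞ 𝕐 ⟧ φ x y ≡ (x + y + fromℕ d) * φ x y

  -- Shifting x or y raises x + y by 1 either way, so the induction hypothesis yields the same
  -- rising factorial in both summands. Once it is taken out, homogeneity supplies the missing first
  -- factor x + y + d.
  ⟦[𝕏+𝕐]^_⟧ : ∀ k {d φ} → Homogeneous d φ → ∀ x y → ⟦ (𝕏 ⊞ 𝕐) ^ k ⟧ φ x y ≡ rise (x + y + fromℕ d) k * φ x y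
  ⟦[𝕏+𝕐]^ zero ⟧  hom x y = ≡.refl
  ⟦[𝕏+𝕐]^ suc k ⟧ {d} {φ} hom x y = begin
    x * ⟦ (𝕏 ⊞ 𝕐) ^ k ⟧ φ (x + 1ℚ) y + y * ⟦ (𝕏 ⊞ 𝕐) ^ k ⟧ φ x (y + 1ℚ)
      ≡⟨ ≡.cong₂ (λ p q → x * p + y * q) (⟦[𝕏+𝕐]^ k ⟧ {d} {φ} hom (x + 1ℚ) y) (⟦[𝕏+𝕐]^ k ⟧ {d} {φ} hom x (y + 1ℚ)) ⟩
    x * (rise (x + 1ℚ + y + e) k * φ (x + 1ℚ) y) + y * (rise (x + (y + 1ℚ) + e) k * φ x (y + 1ℚ))
      ≡⟨ ≡.cong₂ (λ p q → x * (rise p k * φ (x + 1ℚ) y) + y * (rise q k * φ x (y + 1ℚ)))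
           (solve 3 (λ x y e → x :+ con 1ℚ :+ y :+ e := x :+ y :+ e :+ con 1ℚ) ≡.refl x y e)
           (solve 3 (λ x y e → x :+ (y :+ con 1ℚ) :+ e := x :+ y :+ e :+ con 1ℚ) ≡.refl x y e) ⟩
    x * (r * φ (x + 1ℚ) y) + y * (r * φ x (y + 1ℚ))
      ≡⟨ solve 5 (λ x y r p q → x :* (r :* p) :+ y :* (r :* q) := r :* (x :* p :+ y :* q)) ≡.refl x y r (φ (x + 1ℚ) y) (φ x (y + 1ℚ)) ⟩
    r * (x * φ (x + 1ℚ) y + y * φ x (y + 1ℚ))
      ≡⟨ ≡.cong (r *_) (hom x y) ⟩
    r * ((x + y + e) * φ x y)
      ≡⟨ solve 3 (λ r s p → r :* (s :* p) := s :* r :* p) ≡.refl r (x + y + e) (φ x y) ⟩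
    rise (x + y + e) (suc k) * φ x y
      ∎
    where
    e = fromℕ d
    r = rise (x + y + e + 1ℚ) k

  ⟦G𝕐_⟧ : ∀ j x y → ⟦ G 𝕐 j ⟧ (λ _ _ → 1ℚ) x y ≡ γ j * rise y j
  ⟦G𝕐 j ⟧ x y = ≡.cong (γ j *_) (⟦𝕐^ j ⟧ x y)

  ⟦G𝕏_⟧ : ∀ i (ψ : ℚ → ℚ) x y → ⟦ G 𝕏 i ⟧ (λ _ v → ψ v) x y ≡ γ i * rise x i * ψ y
  ⟦G𝕏 i ⟧ ψ x y = ≡.trans (≡.cong (γ i *_) (⟦𝕏^ i ⟧ ψ x y)) (≡.sym (ℚₚ.*-assoc (γ i) _ _))

  -- It is x y / 4 for n = 2 and 0 otherwise, left in the form in which `coth-addition-coeff`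
  -- produces it.
  quadratic : ℕ → Fun
  quadratic n = ⟦ (t· t· const (scalar ½ ⊠ scalar ½ ⊠ (𝕏 ⊠ 𝕐))) n ⟧ (λ _ _ → 1ℚ)

  quadratic-homogeneous : ∀ n → Homogeneous n (quadratic n)
  quadratic-homogeneous zero          x y = solve 3 (λ x y z → x :* (con 0ℚ :* con 1ℚ) :+ y :* (con 0ℚ :* con 1ℚ) := z :* (con 0ℚ :* con 1ℚ)) ≡.refl x y (x + y + fromℕ 0)
  quadratic-homogeneous (suc zero)    x y = solve 3 (λ x y z → x :* (con 0ℚ :* con 1ℚ) :+ y :* (con 0ℚ :* con 1ℚ) := z :* (con 0ℚ :* con 1ℚ)) ≡.refl x y (x + y + fromℕ 1)
  quadratic-homogeneous (suc (suc zero)) x y = solve 2 (λ x y →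
      x :* (con ½ :* (con ½ :* ((x :+ con 1ℚ) :* (y :* con 1ℚ)))) :+ y :* (con ½ :* (con ½ :* (x :* ((y :+ con 1ℚ) :* con 1ℚ))))
        := (x :+ y :+ con (fromℕ 2)) :* (con ½ :* (con ½ :* (x :* (y :* con 1ℚ))))) ≡.refl x y
  quadratic-homogeneous (suc (suc (suc n))) x y = solve 3 (λ x y z → x :* (con 0ℚ :* con 1ℚ) :+ y :* (con 0ℚ :* con 1ℚ) := z :* (con 0ℚ :* con 1ℚ)) ≡.refl x y (x + y + fromℕ (suc (suc (suc n))))

  product : ℕ → Fun
  product n x y = conv n (λ i j → γ i * rise x i * (γ j * rise y j))

  product-homogeneous : ∀ n → Homogeneous n (product n)
  product-homogeneous n x y = begin
    x * product n (x + 1ℚ) y + y * product n x (y + 1ℚ)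
      ≡⟨ ≡.cong₂ _+_ (conv-*ˡ n x _) (conv-*ˡ n y _) ⟩
    conv n (λ i j → x * (γ i * rise (x + 1ℚ) i * (γ j * rise y j))) + conv n (λ i j → y * (γ i * rise x i * (γ j * rise (y + 1ℚ) j)))
      ≡⟨ conv-+ n _ _ ⟨
    conv n (λ i j → x * (γ i * rise (x + 1ℚ) i * (γ j * rise y j)) + y * (γ i * rise x i * (γ j * rise (y + 1ℚ) j)))
      ≡⟨ conv-cong n term ⟩
    conv n (λ i j → (x + y + fromℕ n) * (γ i * rise x i * (γ j * rise y j)))
      ≡⟨ conv-*ˡ n (x + y + fromℕ n) _ ⟨
    (x + y + fromℕ n) * product n x y
      ∎
    where
    term : ∀ i j → i ℕ.+ j ≡ n →
      x * (γ i * rise (x + 1ℚ) i * (γ j * rise y j)) + y * (γ i * rise x i * (γ j * rise (y + 1ℚ) j))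
        ≡ (x + y + fromℕ n) * (γ i * rise x i * (γ j * rise y j))
    term i j ≡.refl = begin
      x * (γ i * rise (x + 1ℚ) i * (γ j * rise y j)) + y * (γ i * rise x i * (γ j * rise (y + 1ℚ) j))
        ≡⟨ solve 8 (λ x y a b p q r s → x :* (a :* p :* (b :* s)) :+ y :* (a :* r :* (b :* q)) := a :* b :* (x :* p :* s :+ r :* (y :* q)))
             ≡.refl x y (γ i) (γ j) (rise (x + 1ℚ) i) (rise (y + 1ℚ) j) (rise x i) (rise y j) ⟩
      γ i * γ j * (x * rise (x + 1ℚ) i * rise y j + rise x i * (y * rise (y + 1ℚ) j))
        ≡⟨ ≡.cong₂ (λ p q → γ i * γ j * (p * rise y j + rise x i * q)) (rise-suc x i) (rise-suc y j) ⟩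
      γ i * γ j * ((x + fromℕ i) * rise x i * rise y j + rise x i * ((y + fromℕ j) * rise y j))
        ≡⟨ solve 8 (λ x y a b m n r s → a :* b :* ((x :+ m) :* r :* s :+ r :* ((y :+ n) :* s)) := (x :+ y :+ (m :+ n)) :* (a :* r :* (b :* s)))
             ≡.refl x y (γ i) (γ j) (fromℕ i) (fromℕ j) (rise x i) (rise y j) ⟩
      (x + y + (fromℕ i + fromℕ j)) * (γ i * rise x i * (γ j * rise y j))
        ≡⟨ ≡.cong (λ z → (x + y + z) * (γ i * rise x i * (γ j * rise y j))) (fromℤ-+ (+ i) (+ j)) ⟨
      (x + y + fromℕ (i ℕ.+ j)) * (γ i * rise x i * (γ j * rise y j))
        ∎

  cross : ℕ → Fun
  cross j x y = y * (γ j * rise x j) + x * (γ j * rise y j)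

  -- The extra factor b or a raises the degree from j to j + 1. This is where the 1 in the base x +
  -- y + 2w + 1 comes from.
  cross-homogeneous : ∀ j → Homogeneous (suc j) (cross j)
  cross-homogeneous j x y = begin
    x * (y * (γ j * rise (x + 1ℚ) j) + (x + 1ℚ) * (γ j * rise y j)) + y * ((y + 1ℚ) * (γ j * rise x j) + x * (γ j * rise (y + 1ℚ) j))
      ≡⟨ solve 7 (λ x y a p q r s → x :* (y :* (a :* p) :+ (x :+ con 1ℚ) :* (a :* s)) :+ y :* ((y :+ con 1ℚ) :* (a :* r) :+ x :* (a :* q))
           := a :* (y :* (x :* p) :+ x :* (x :+ con 1ℚ) :* s :+ y :* (y :+ con 1ℚ) :* r :+ x :* (y :* q)))
           ≡.refl x y (γ j) (rise (x + 1ℚ) j) (rise (y + 1ℚ) j) (rise x j) (rise y j) ⟩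
    γ j * (y * (x * rise (x + 1ℚ) j) + x * (x + 1ℚ) * rise y j + y * (y + 1ℚ) * rise x j + x * (y * rise (y + 1ℚ) j))
      ≡⟨ ≡.cong₂ (λ p q → γ j * (y * p + x * (x + 1ℚ) * rise y j + y * (y + 1ℚ) * rise x j + x * q)) (rise-suc x j) (rise-suc y j) ⟩
    γ j * (y * ((x + fromℕ j) * rise x j) + x * (x + 1ℚ) * rise y j + y * (y + 1ℚ) * rise x j + x * ((y + fromℕ j) * rise y j))
      ≡⟨ solve 6 (λ x y a n r s → a :* (y :* ((x :+ n) :* r) :+ x :* (x :+ con 1ℚ) :* s :+ y :* (y :+ con 1ℚ) :* r :+ x :* ((y :+ n) :* s))
           := (x :+ y :+ (con 1ℚ :+ n)) :* (y :* (a :* r) :+ x :* (a :* s)))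
           ≡.refl x y (γ j) (fromℕ j) (rise x j) (rise y j) ⟩
    (x + y + (1ℚ + fromℕ j)) * cross j x y
      ≡⟨ ≡.cong (λ z → (x + y + z) * cross j x y) (fromℕ-suc j) ⟨
    (x + y + fromℕ (suc j)) * cross j x y
      ∎

  rise-convolution : ∀ n x y →
    (x + y + fromℕ n) * (product n x y + quadratic n x y)
      ≡ conv n (λ k j → γ k * (rise (x + y + fromℕ (suc j)) k * cross j x y))
  rise-convolution n x y = begin
    (x + y + fromℕ n) * (product n x y + quadratic n x y)
      ≡⟨ ℚₚ.*-distribˡ-+ (x + y + fromℕ n) (product n x y) (quadratic n x y) ⟩
    (x + y + fromℕ n) * product n x y + (x + y + fromℕ n) * quadratic n x y
      ≡⟨ ≡.cong₂ _+_ (product-homogeneous n x y) (quadratic-homogeneous n x y) ⟨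
    ⟦ 𝕏 ⊞ 𝕐 ⟧ (product n) x y + ⟦ 𝕏 ⊞ 𝕐 ⟧ (quadratic n) x y
      ≡⟨ ⟦ 𝕏 ⊞ 𝕐 ⟧-+ (product n) (quadratic n) x y ⟨
    ⟦ 𝕏 ⊞ 𝕐 ⟧ (λ u v → product n u v + quadratic n u v) x y
      ≡⟨ ⟦ 𝕏 ⊞ 𝕐 ⟧-cong (λ u v → ≡.cong (_+ quadratic n u v) (≡.sym (eval-product u v))) x y ⟩
    ⟦ (𝕏 ⊞ 𝕐) ⊠ (Op[[t]].conv n (λ i j → G 𝕏 i ⊠ G 𝕐 j) ⊞ (t· t· const (scalar ½ ⊠ scalar ½ ⊠ (𝕏 ⊠ 𝕐))) n) ⟧ 𝟏 x y
      ≡⟨ coth-addition-coeff 𝕏 𝕐 n 𝟏 x y ⟩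
    ⟦ Op[[t]].conv n (λ k j → G (𝕏 ⊞ 𝕐) k ⊠ (𝕐 ⊠ G 𝕏 j ⊞ 𝕏 ⊠ G 𝕐 j)) ⟧ 𝟏 x y
      ≡⟨ ⟦conv⟧ n _ 𝟏 x y ⟩
    conv n (λ k j → γ k * ⟦ (𝕏 ⊞ 𝕐) ^ k ⟧ (⟦ 𝕐 ⊠ G 𝕏 j ⊞ 𝕏 ⊠ G 𝕐 j ⟧ 𝟏) x y)
      -- The inner operator is evaluated first: it gives `cross j`, whose homogeneity then evaluates
      -- the power of `𝕏 ⊞ 𝕐`.
      ≡⟨ conv-cong′ n (λ k j → ≡.cong (γ k *_) (≡.trans (⟦ (𝕏 ⊞ 𝕐) ^ k ⟧-cong (eval-cross j) x y) (⟦[𝕏+𝕐]^ k ⟧ {suc j} (cross-homogeneous j) x y))) ⟩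
    conv n (λ k j → γ k * (rise (x + y + fromℕ (suc j)) k * cross j x y))
      ∎
    where
    𝟏 : Fun
    𝟏 _ _ = 1ℚ
    eval-product : ∀ u v → ⟦ Op[[t]].conv n (λ i j → G 𝕏 i ⊠ G 𝕐 j) ⟧ 𝟏 u v ≡ product n u v
    eval-product u v = ≡.trans (⟦conv⟧ n _ 𝟏 u v)
      (conv-cong′ n (λ i j → ≡.trans (⟦ G 𝕏 i ⟧-cong (⟦G𝕐 j ⟧) u v) (⟦G𝕏 i ⟧ (λ v → γ j * rise v j) u v)))
    eval-cross : ∀ j u v → ⟦ 𝕐 ⊠ G 𝕏 j ⊞ 𝕏 ⊠ G 𝕐 j ⟧ 𝟏 u v ≡ cross j u v
    eval-cross j u v = ≡.cong₂ (λ p q → v * p + u * q) (≡.trans (⟦G𝕏 j ⟧ (λ _ → 1ℚ) u (v + 1ℚ)) (ℚₚ.*-identityʳ _)) (⟦G𝕐 j ⟧ (u + 1ℚ) v)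

-- Parity of γ and restriction to even degrees

open Operators using (product; quadratic; cross; rise-convolution)
open import Algebra.Properties.Semiring.Exp (CommutativeSemiring.semiring ℚ-semiring) using (_^_)

2*suc : ∀ n → 2 ℕ.* suc n ≡ suc (suc (2 ℕ.* n))
2*suc n = ≡.cong suc (ℕₚ.+-suc n (n ℕ.+ 0))

-1^2n : ∀ n → (- 1ℚ) ^ (2 ℕ.* n) ≡ 1ℚ
-1^2n zero    = ≡.refl
-1^2n (suc n) = ≡.trans (≡.cong ((- 1ℚ) ^_) (2*suc n)) (≡.cong (λ z → - 1ℚ * (- 1ℚ * z)) (-1^2n n))

1^n : ∀ n → 1ℚ ^ n ≡ 1ℚ
1^n zero    = ≡.refl
1^n (suc n) = ≡.cong (1ℚ *_) (1^n n)

-- The addition theorem for a = 1 and b = - 1 reads 0 = G(- t) - G(t).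
γ-odd : ∀ n → γ (suc (2 ℕ.* n)) ≡ 0ℚ
γ-odd n = begin
  -- Since a + b = 0, powers of 0 leave only the term with k = 0. In odd degree this term is -2
  -- times `c`, whence the factor `-½`.
  c                                                      ≡⟨ solve 1 (λ c → c := con -½ :* ((con 1ℚ :* con 1ℚ) :* (con (- 1ℚ) :* (c :* con 1ℚ) :+ con 1ℚ :* (c :* con (- 1ℚ))) :+ con 0ℚ)) ≡.refl c ⟩
  -½ * (1ℚ * 1ℚ * (- 1ℚ * (c * 1ℚ) + 1ℚ * (c * (- 1ℚ))) + 0ℚ)
    ≡⟨ ≡.cong (-½ *_) (≡.cong₂ _+_ (≡.cong₂ (λ p q → 1ℚ * 1ℚ * (- 1ℚ * (c * p) + 1ℚ * (c * q))) (1^n (suc (2 ℕ.* n))) (≡.cong (- 1ℚ *_) (-1^2n n))) rest) ⟨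
  -½ * conv (suc (2 ℕ.* n)) (λ k j → G 0ℚ k * (- 1ℚ * G 1ℚ j + 1ℚ * G (- 1ℚ) j))
    ≡⟨ ≡.cong (-½ *_) (coth-addition-coeff 1ℚ (- 1ℚ) (suc (2 ℕ.* n))) ⟨
  -½ * (0ℚ * L)                                          ≡⟨ ≡.cong (-½ *_) (ℚₚ.*-zeroˡ L) ⟩
  0ℚ                                                     ∎
  where
  open ScaledSeries ℚ-semiring (λ q → q) (λ _ _ → ≡.refl) (λ _ _ → ≡.refl) ≡.refl ≡.refl
  open ℚ[[t]] using (t·_; const)
  c L : ℚ
  c = γ (suc (2 ℕ.* n))
  L = conv (suc (2 ℕ.* n)) (λ i j → G 1ℚ i * G (- 1ℚ) j) + (t· t· const (½ * ½ * (1ℚ * - 1ℚ))) (suc (2 ℕ.* n))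
  rest : conv (2 ℕ.* n) (λ k j → G 0ℚ (suc k) * (- 1ℚ * G 1ℚ j + 1ℚ * G (- 1ℚ) j)) ≡ 0ℚ
  rest = conv-0 (2 ℕ.* n) (λ k j _ →
    solve 3 (λ c p z → c :* (con 0ℚ :* p) :* z := con 0ℚ) ≡.refl (γ (suc k)) (0ℚ ^ k) (- 1ℚ * G 1ℚ j + 1ℚ * G (- 1ℚ) j))

-- In an even total the two indices are odd together, so vanishing at odd first index removes every
-- term with an odd index. The induction peels off two terms at a time.
conv-even : ∀ n F → (∀ i j → F (suc (2 ℕ.* i)) j ≡ 0ℚ) → conv (2 ℕ.* n) F ≡ conv n (λ i j → F (2 ℕ.* i) (2 ℕ.* j))
conv-even zero    F odd = ≡.refl
conv-even (suc n) F odd = begin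
  conv (2 ℕ.* suc n) F
    ≡⟨ ≡.cong (λ m → conv m F) (2*suc n) ⟩
  F 0 (suc (suc m)) + (F 1 (suc m) + conv m (λ i j → F (suc (suc i)) j))
    ≡⟨ ≡.cong₂ (λ p q → F 0 p + q) (≡.sym (2*suc n)) (≡.trans (≡.cong (_+ conv m (λ i j → F (suc (suc i)) j)) (odd 0 (suc m))) (ℚₚ.+-identityˡ _)) ⟩
  F 0 (2 ℕ.* suc n) + conv m (λ i j → F (suc (suc i)) j)
    ≡⟨ ≡.cong (λ z → F 0 (2 ℕ.* suc n) + z) (conv-even n _ (λ i j → ≡.trans (≡.cong (λ k → F (suc k) j) (≡.sym (2*suc i))) (odd (suc i) j))) ⟩
  F 0 (2 ℕ.* suc n) + conv n (λ i j → F (suc (suc (2 ℕ.* i))) (2 ℕ.* j))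
    ≡⟨ ≡.cong (λ z → F 0 (2 ℕ.* suc n) + z) (conv-cong′ n (λ i j → ≡.cong (λ k → F k (2 ℕ.* j)) (≡.sym (2*suc i)))) ⟩
  conv (suc n) (λ i j → F (2 ℕ.* i) (2 ℕ.* j))
    ∎
  where m = 2 ℕ.* n

rise-convolution-even : ∀ n x y →
  (x + y + fromℕ (2 ℕ.* n)) * (conv n (λ i j → γ (2 ℕ.* i) * rise x (2 ℕ.* i) * (γ (2 ℕ.* j) * rise y (2 ℕ.* j))) + quadratic (2 ℕ.* n) x y)
    ≡ conv n (λ k j → γ (2 ℕ.* k) * (rise (x + y + fromℕ (suc (2 ℕ.* j))) (2 ℕ.* k) * cross (2 ℕ.* j) x y))
rise-convolution-even n x y = begin
  (x + y + fromℕ (2 ℕ.* n)) * (conv n _ + quadratic (2 ℕ.* n) x y)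
    ≡⟨ ≡.cong (λ z → (x + y + fromℕ (2 ℕ.* n)) * (z + quadratic (2 ℕ.* n) x y))
         (conv-even n (λ i j → γ i * rise x i * (γ j * rise y j)) (λ i j → ≡.trans (≡.cong (λ z → z * rise x (suc (2 ℕ.* i)) * (γ j * rise y j)) (γ-odd i))
           (solve 2 (λ r s → con 0ℚ :* r :* s := con 0ℚ) ≡.refl (rise x (suc (2 ℕ.* i))) (γ j * rise y j)))) ⟨
  (x + y + fromℕ (2 ℕ.* n)) * (product (2 ℕ.* n) x y + quadratic (2 ℕ.* n) x y)
    ≡⟨ rise-convolution (2 ℕ.* n) x y ⟩
  conv (2 ℕ.* n) (λ k j → γ k * (rise (x + y + fromℕ (suc j)) k * cross j x y))
    ≡⟨ conv-even n _ (λ k j → ≡.trans (≡.cong (λ z → z * (rise (x + y + fromℕ (suc j)) (suc (2 ℕ.* k)) * cross j x y)) (γ-odd k))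
         (ℚₚ.*-zeroˡ (rise (x + y + fromℕ (suc j)) (suc (2 ℕ.* k)) * cross j x y))) ⟩
  _ ∎

-- Division by integers, and binomial coefficients as rising factorials

fromℤ-neg : ∀ z → fromℤ (ℤ.- z) ≡ - fromℤ z
fromℤ-neg z = begin
  fromℤ (ℤ.- z)                          ≡⟨ solve 2 (λ a b → a := (b :+ a) :+ :- b) ≡.refl (fromℤ (ℤ.- z)) (fromℤ z) ⟩
  (fromℤ z + fromℤ (ℤ.- z)) + - fromℤ z  ≡⟨ ≡.cong (_+ - fromℤ z) (≡.trans (≡.sym (fromℤ-+ z (ℤ.- z))) (≡.cong fromℤ (ℤₚ.+-inverseʳ z))) ⟩
  0ℚ + - fromℤ z                         ≡⟨ ℚₚ.+-identityˡ _ ⟩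
  - fromℤ z                              ∎

d*[a÷d] : ∀ a {d} → d ≢ + 0 → fromℤ d * (a ÷ d) ≡ fromℤ a
d*[a÷d] a {+ zero}   d≢0 = ⊥-elim (d≢0 ≡.refl)
d*[a÷d] a {+ suc d}  _   = d*[i/d] a (suc d)
d*[a÷d] a { -[1+ d ]} _   = begin
  fromℤ -[1+ d ] * ((ℤ.- a) ℚ./ suc d)        ≡⟨ ≡.cong (_* ((ℤ.- a) ℚ./ suc d)) (fromℤ-neg (+ suc d)) ⟩
  - fromℕ (suc d) * ((ℤ.- a) ℚ./ suc d)       ≡⟨ ℚₚ.neg-distribˡ-* (fromℕ (suc d)) _ ⟨
  - (fromℕ (suc d) * ((ℤ.- a) ℚ./ suc d))     ≡⟨ ≡.cong -_ (d*[i/d] (ℤ.- a) (suc d)) ⟩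
  - fromℤ (ℤ.- a)                             ≡⟨ fromℤ-neg (ℤ.- a) ⟨
  fromℤ (ℤ.- (ℤ.- a))                         ≡⟨ ≡.cong fromℤ (ℤₚ.neg-involutive a) ⟩
  fromℤ a                                     ∎

fromℤ-*-cancelˡ : ∀ {d p q} → d ≢ + 0 → fromℤ d * p ≡ fromℤ d * q → p ≡ q
fromℤ-*-cancelˡ {d} {p} {q} d≢0 eq = begin
  p                            ≡⟨ inverse p ⟩
  (+ 1 ÷ d) * (fromℤ d * p)    ≡⟨ ≡.cong ((+ 1 ÷ d) *_) eq ⟩
  (+ 1 ÷ d) * (fromℤ d * q)    ≡⟨ inverse q ⟨
  q                            ∎
  where
  inverse : ∀ r → r ≡ (+ 1 ÷ d) * (fromℤ d * r)
  inverse r = begin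
    r                                ≡⟨ ℚₚ.*-identityˡ r ⟨
    1ℚ * r                           ≡⟨ ≡.cong (_* r) (d*[a÷d] (+ 1) d≢0) ⟨
    fromℤ d * (+ 1 ÷ d) * r          ≡⟨ solve 3 (λ d e r → d :* e :* r := e :* (d :* r)) ≡.refl (fromℤ d) (+ 1 ÷ d) r ⟩
    (+ 1 ÷ d) * (fromℤ d * r)        ∎

m!*rise : ∀ m k → fromℕ (m !) * rise (fromℕ m + 1ℚ) k ≡ fromℕ ((m ℕ.+ k) !)
m!*rise m zero    = ≡.trans (ℚₚ.*-identityʳ _) (≡.cong (λ n → fromℕ (n !)) (≡.sym (ℕₚ.+-identityʳ m)))
m!*rise m (suc k) = begin
  fromℕ (m !) * ((fromℕ m + 1ℚ) * rise (fromℕ m + 1ℚ + 1ℚ) k)   ≡⟨ ≡.cong (λ z → fromℕ (m !) * (z * rise (z + 1ℚ) k)) (≡.trans (ℚₚ.+-comm (fromℕ m) 1ℚ) (≡.sym (fromℕ-suc m))) ⟩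
  fromℕ (m !) * (fromℕ (suc m) * rise (fromℕ (suc m) + 1ℚ) k)   ≡⟨ solve 3 (λ a b r → a :* (b :* r) := b :* a :* r) ≡.refl (fromℕ (m !)) (fromℕ (suc m)) (rise (fromℕ (suc m) + 1ℚ) k) ⟩
  fromℕ (suc m) * fromℕ (m !) * rise (fromℕ (suc m) + 1ℚ) k     ≡⟨ ≡.cong (_* rise (fromℕ (suc m) + 1ℚ) k) (fromℕ-* (suc m) (m !)) ⟨
  fromℕ (suc m !) * rise (fromℕ (suc m) + 1ℚ) k                 ≡⟨ m!*rise (suc m) k ⟩
  fromℕ ((suc m ℕ.+ k) !)                                       ≡⟨ ≡.cong (λ n → fromℕ (n !)) (ℕₚ.+-suc m k) ⟨
  fromℕ ((m ℕ.+ suc k) !)                                       ∎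

[m+k]Cm*m!k! : ∀ m k → ((m ℕ.+ k) C m) ℕ.* (m ! ℕ.* k !) ≡ (m ℕ.+ k) !
[m+k]Cm*m!k! m k = begin
  ((m ℕ.+ k) C m) ℕ.* (m ! ℕ.* k !)   ≡⟨ ≡.cong₂ (λ c j → c ℕ.* (m ! ℕ.* j !)) (nCk≡n!/k![n-k]! m≤m+k) (≡.sym (ℕₚ.m+n∸m≡n m k)) ⟩
  ((m ℕ.+ k) ! ℕ./ (m ! ℕ.* (m ℕ.+ k ∸ m) !)) {{m ℕₚ.!* (m ℕ.+ k ∸ m) !≢0}} ℕ.* (m ! ℕ.* (m ℕ.+ k ∸ m) !) ≡⟨ ℕ.m/n*n≡m {{m ℕₚ.!* (m ℕ.+ k ∸ m) !≢0}} (≡.subst (ℕ._∣ (m ℕ.+ k) !) (ℕₚ.*-comm ((m ℕ.+ k ∸ m) !) (m !)) ([n∸k]!k!∣n! m≤m+k)) ⟩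
  (m ℕ.+ k) !                         ∎
  where m≤m+k = ℕₚ.m≤m+n m k

-- After multiplication by m! both sides are (m + k)!. The factor k! will come from `B k`, so that
-- only `bern k` and a rising factorial remain.
[m+k]Cm*k! : ∀ m k → fromℕ ((m ℕ.+ k) C m) * fromℕ (k !) ≡ rise (fromℕ m + 1ℚ) k
[m+k]Cm*k! m k = fromℤ-*-cancelˡ {+ (m !)} (λ eq → ℕ.≢-nonZero⁻¹ (m !) {{m ℕₚ.!≢0}} (ℤₚ.+-injective eq)) (begin
  fromℕ (m !) * (c * fromℕ (k !))              ≡⟨ solve 3 (λ a b c → a :* (b :* c) := b :* (a :* c)) ≡.refl (fromℕ (m !)) c (fromℕ (k !)) ⟩
  c * (fromℕ (m !) * fromℕ (k !))              ≡⟨ ≡.cong (c *_) (fromℕ-* (m !) (k !)) ⟨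
  c * fromℕ (m ! ℕ.* k !)                      ≡⟨ fromℕ-* ((m ℕ.+ k) C m) (m ! ℕ.* k !) ⟨
  fromℕ (((m ℕ.+ k) C m) ℕ.* (m ! ℕ.* k !))    ≡⟨ ≡.cong fromℕ ([m+k]Cm*m!k! m k) ⟩
  fromℕ ((m ℕ.+ k) !)                          ≡⟨ m!*rise m k ⟨
  fromℕ (m !) * rise (fromℕ m + 1ℚ) k          ∎)
  where c = fromℕ ((m ℕ.+ k) C m)

-- The factors -p, -p + 1, ... reach 0 within the first p + 1 of them. This agrees with binomial
-- coefficients being 0 for negative lower argument.
rise-vanish : ∀ {p k} → p ℕ.< k → rise (- fromℕ p) k ≡ 0ℚ
rise-vanish {zero}  {suc k} _           = ℚₚ.*-zeroˡ (rise 1ℚ k)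
rise-vanish {suc p} {suc k} (ℕ.s≤s p<k) = begin
  - fromℕ (suc p) * rise (- fromℕ (suc p) + 1ℚ) k  ≡⟨ ≡.cong (λ z → - fromℕ (suc p) * rise z k) (≡.trans (≡.cong (λ z → - z + 1ℚ) (fromℕ-suc p)) (solve 1 (λ p → :- (con 1ℚ :+ p) :+ con 1ℚ := :- p) ≡.refl (fromℕ p))) ⟩
  - fromℕ (suc p) * rise (- fromℕ p) k             ≡⟨ ≡.cong (- fromℕ (suc p) *_) (rise-vanish p<k) ⟩
  - fromℕ (suc p) * 0ℚ                             ≡⟨ ℚₚ.*-zeroʳ (- fromℕ (suc p)) ⟩
  0ℚ                                               ∎

-- The factors on the left are those of x⁽ᵏ⁾ in reverse order, each with its sign changed.
rise-reflect : ∀ x k → rise (- (x + fromℕ k) + 1ℚ) k ≡ (- 1ℚ) ^ k * rise x k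
rise-reflect x zero    = ≡.refl
rise-reflect x (suc k) = begin
  rise (- (x + fromℕ (suc k)) + 1ℚ) (suc k)                        ≡⟨ ≡.cong (λ z → rise z (suc k)) (≡.trans (≡.cong (λ z → - (x + z) + 1ℚ) (fromℕ-suc k)) (solve 2 (λ x k → :- (x :+ (con 1ℚ :+ k)) :+ con 1ℚ := :- (x :+ k)) ≡.refl x (fromℕ k))) ⟩
  - (x + fromℕ k) * rise (- (x + fromℕ k) + 1ℚ) k                  ≡⟨ ≡.cong (- (x + fromℕ k) *_) (rise-reflect x k) ⟩
  - (x + fromℕ k) * ((- 1ℚ) ^ k * rise x k)                        ≡⟨ solve 3 (λ y s r → (:- y) :* (s :* r) := (con (- 1ℚ)) :* s :* (y :* r)) ≡.refl (x + fromℕ k) ((- 1ℚ) ^ k) (rise x k) ⟩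
  (- 1ℚ) ^ suc k * ((x + fromℕ k) * rise x k)                      ≡⟨ ≡.cong ((- 1ℚ) ^ suc k *_) (rise-suc x k) ⟨
  (- 1ℚ) ^ suc k * rise x (suc k)                                  ∎

-- Evaluation of b

T⇒≡true : ∀ {c} → T c → c ≡ true
T⇒≡true {true} _ = ≡.refl

¬T⇒≡false : ∀ {c} → ¬ T c → c ≡ false
¬T⇒≡false {true}  ¬c = ⊥-elim (¬c _)
¬T⇒≡false {false} _  = ≡.refl

⌊/2⌋-< : ∀ {a k} → a ℤ.< k ℤ.* + 2 → ⌊ a /2⌋ ℤ.< k
⌊/2⌋-< {a} a<2k = ℤₚ.*-cancelʳ-<-nonNeg (+ 2) (ℤₚ.≤-<-trans (ℤ.[n/ℕd]*d≤n a 2) a<2k)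

⌊/2⌋-≤ : ∀ {a k} → k ℤ.* + 2 ℤ.≤ a → k ℤ.≤ ⌊ a /2⌋
⌊/2⌋-≤ {a} {k} 2k≤a = ℤₚ.≮⇒≥ (λ ⌊a/2⌋<k → ℤₚ.≤⇒≯ (ℤₚ.i<j⇒suc[i]≤j ⌊a/2⌋<k)
  (ℤₚ.*-cancelʳ-<-nonNeg (+ 2) (ℤₚ.≤-<-trans 2k≤a (ℤ.n<s[n/ℕd]*d a 2))))

module _ (q : ℤ) (n i : ℕ) (i≤n : i ℕ.≤ n) where
  private
    2n+q 2i+q : ℤ
    2n+q = + 2 ℤ.* + n ℤ.+ q
    2i+q = + 2 ℤ.* + i ℤ.+ q

    n≮i : (n ℕ.<ᵇ i) ≡ false
    n≮i = ¬T⇒≡false (λ n<i → ℕₚ.≤⇒≯ i≤n (ℕₚ.<ᵇ⇒< n i n<i))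

    -q+[2n+q] : ℤ.- q ℤ.+ 2n+q ≡ + n ℤ.* + 2
    -q+[2n+q] = ℤ+*.solve 2 (λ q n → ℤ+*.:- q ℤ+*.:+ (ℤ+*.con (+ 2) ℤ+*.:* n ℤ+*.:+ q) ℤ+*.:= n ℤ+*.:* ℤ+*.con (+ 2)) ≡.refl q (+ n)

  module _ (0<2n+q : + 0 ℤ.< 2n+q) where
    private
      bound : (+ 0 ℤ.⊔ (⌊ ℤ.- q /2⌋ ℤ.+ + 1)) ℤ.≤ + n
      bound = ℤₚ.⊔-lub (ℤ.+≤+ ℕ.z≤n) (≡.subst (ℤ._≤ + n) (ℤₚ.+-comm (+ 1) ⌊ ℤ.- q /2⌋)
        (ℤₚ.i<j⇒suc[i]≤j (⌊/2⌋-< (≡.subst₂ ℤ._<_ (ℤₚ.+-identityʳ (ℤ.- q)) -q+[2n+q] (ℤₚ.+-monoʳ-< (ℤ.- q) 0<2n+q)))))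

    -- As ⌊-q/2⌋ < n amounts to -q < 2n, the first test in `b` is the condition 2n + q > 0 in
    -- disguise.
    b-pos : b q (+ n) i ≡ (+ 2 ÷ 2n+q) * fromℕ (binom 2n+q 2i+q) * B (2 ℕ.* (n ∸ i))
    b-pos rewrite n≮i | T⇒≡true (ℤₚ.≤⇒≤ᵇ bound) = ≡.refl

  module _ (2n+q<0 : 2n+q ℤ.< + 0) where
    private
      2n<-q : + n ℤ.* + 2 ℤ.< ℤ.- q
      2n<-q = ≡.subst₂ ℤ._<_ -q+[2n+q] (ℤₚ.+-identityʳ (ℤ.- q)) (ℤₚ.+-monoʳ-< (ℤ.- q) 2n+q<0)

      bound : ¬ ((+ 0 ℤ.⊔ (⌊ ℤ.- q /2⌋ ℤ.+ + 1)) ℤ.≤ + n)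
      bound le = ℤₚ.≤⇒≯ (⌊/2⌋-≤ (ℤₚ.<⇒≤ 2n<-q))
        (ℤₚ.suc[i]≤j⇒i<j (≡.subst (ℤ._≤ + n) (ℤₚ.+-comm ⌊ ℤ.- q /2⌋ (+ 1)) (ℤₚ.≤-trans (ℤₚ.i≤j⊔i (+ 0) (⌊ ℤ.- q /2⌋ ℤ.+ + 1)) le)))

      bound′ : + n ℤ.≤ ⌊ ℤ.- (q ℤ.+ + 1) /2⌋
      bound′ = ⌊/2⌋-≤ (≡.subst₂ ℤ._≤_
        (≡.trans (≡.sym (ℤₚ.+-assoc (ℤ.- + 1) (+ 1) (+ n ℤ.* + 2))) (ℤₚ.+-identityˡ (+ n ℤ.* + 2)))
        (≡.trans (ℤₚ.+-comm (ℤ.- + 1) (ℤ.- q)) (≡.sym (ℤₚ.neg-distrib-+ q (+ 1))))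
        (ℤₚ.+-monoʳ-≤ (ℤ.- + 1) (ℤₚ.i<j⇒suc[i]≤j 2n<-q)))

    -- From 2n < -q one gets n ≤ ⌊-q/2⌋, so the first test fails; by integrality also 2n ≤ -(q + 1),
    -- which is the second test.
    b-neg : b q (+ n) i ≡ (+ 2 ÷ 2i+q) * fromℕ (binom (ℤ.- 2i+q) (ℤ.- 2n+q)) * B (2 ℕ.* (n ∸ i))
    b-neg rewrite n≮i | ¬T⇒≡false (λ c → bound (ℤₚ.≤ᵇ⇒≤ c)) | T⇒≡true (ℤₚ.≤⇒≤ᵇ bound′) = ≡.refl

2ℚ : ℚ
2ℚ = fromℕ 2

-- To be read with P = 2n + q, z = 2i + q and k = 2(n - i). For z ≥ 0 the binomial coefficient
-- absorbs k!. For z < 0 it is 0, and so is (z + 1)⁽ᵏ⁾, because z + k > 0 forces a factor 0.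
pos-value : ∀ {P} z k → P ≡ z ℤ.+ + k → + 0 ℤ.< P →
  fromℤ P * ((+ 2 ÷ P) * fromℕ (binom P z) * B k) ≡ 2ℚ * (bern k * rise (fromℤ z + 1ℚ) k)
pos-value {+ N} z k eq 0<P = begin
  fromℕ N * ((+ 2 ÷ + N) * fromℕ (binom (+ N) z) * (fromℕ (k !) * bern k))
    ≡⟨ solve 5 (λ p d c f β → p :* (d :* c :* (f :* β)) := p :* d :* (β :* (c :* f))) ≡.refl (fromℕ N) (+ 2 ÷ + N) (fromℕ (binom (+ N) z)) (fromℕ (k !)) (bern k) ⟩
  fromℕ N * (+ 2 ÷ + N) * (bern k * (fromℕ (binom (+ N) z) * fromℕ (k !)))
    ≡⟨ ≡.cong₂ (λ p q → p * (bern k * q)) (d*[a÷d] (+ 2) (λ eq → ℤₚ.<⇒≢ 0<P (≡.sym eq))) (binomial z eq) ⟩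
  2ℚ * (bern k * rise (fromℤ z + 1ℚ) k)
    ∎
  where
  binomial : ∀ z → + N ≡ z ℤ.+ + k → fromℕ (binom (+ N) z) * fromℕ (k !) ≡ rise (fromℤ z + 1ℚ) k
  binomial (+ m)    ≡.refl = [m+k]Cm*k! m k
  binomial -[1+ p ] eq     = begin
    0ℚ * fromℕ (k !)              ≡⟨ ℚₚ.*-zeroˡ (fromℕ (k !)) ⟩
    0ℚ                            ≡⟨ rise-vanish (ℕₚ.<-trans (ℕₚ.n<1+n p) (ℤₚ.drop‿+<+ 1+p<k)) ⟨
    rise (- fromℕ p) k            ≡⟨ ≡.cong (λ x → rise x k) (≡.trans (≡.sym (fromℤ-neg (+ p))) (≡.trans (≡.cong fromℤ (neg-suc p)) (fromℤ-+ -[1+ p ] (+ 1)))) ⟩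
    rise (fromℤ -[1+ p ] + 1ℚ) k  ∎
    where
    neg-suc : ∀ p → ℤ.- + p ≡ -[1+ p ] ℤ.+ + 1
    neg-suc zero    = ≡.refl
    neg-suc (suc p) = ≡.refl
    1+p<k : + suc p ℤ.< + k
    1+p<k = ≡.subst₂ ℤ._<_ (ℤₚ.+-identityʳ (+ suc p)) (≡.trans (≡.sym (ℤₚ.+-assoc (+ suc p) -[1+ p ] (+ k))) (≡.trans (≡.cong (ℤ._+ + k) (ℤₚ.+-inverseʳ (+ suc p))) (ℤₚ.+-identityˡ (+ k))))
      (ℤₚ.+-monoʳ-< (+ suc p) (≡.subst (+ 0 ℤ.<_) eq 0<P))

-- Here 2n + q is `- w` and 2i + q is z = -(w + k). The binomial coefficient gives (w + 1)⁽ᵏ⁾, and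
-- `rise-suc` trades the factor w for w + k, which cancels the denominator z. Reflection turns w⁽ᵏ⁾
-- into (z + 1)⁽ᵏ⁾ without a sign, as k is even.
neg-value : ∀ M j → let k = 2 ℕ.* j; z = -[1+ M ℕ.+ k ] in
  fromℤ -[1+ M ] * ((+ 2 ÷ z) * fromℕ (binom (ℤ.- z) (+ suc M)) * B k) ≡ 2ℚ * (bern k * rise (fromℤ z + 1ℚ) k)
neg-value M j = begin
  fromℤ -[1+ M ] * (d * c * (f * β))
    ≡⟨ ≡.cong (_* (d * c * (f * β))) (fromℤ-neg (+ suc M)) ⟩
  - w * (d * c * (f * β))
    ≡⟨ solve 5 (λ w d c f β → (:- w) :* (d :* c :* (f :* β)) := (:- d) :* β :* (w :* (c :* f))) ≡.refl w d c f β ⟩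
  - d * β * (w * (c * f))
    ≡⟨ ≡.cong (λ r → - d * β * (w * r)) ([m+k]Cm*k! (suc M) k) ⟩
  - d * β * (w * rise (w + 1ℚ) k)
    ≡⟨ ≡.cong (- d * β *_) (rise-suc w k) ⟩
  - d * β * ((w + fromℕ k) * rise w k)
    ≡⟨ solve 4 (λ d β y r → (:- d) :* β :* (y :* r) := (:- y) :* d :* (β :* r)) ≡.refl d β (w + fromℕ k) (rise w k) ⟩
  - (w + fromℕ k) * d * (β * rise w k)
    ≡⟨ ≡.cong (λ y → y * d * (β * rise w k)) z≡ ⟨
  fromℤ z * d * (β * rise w k)
    ≡⟨ ≡.cong₂ (λ y r → y * (β * r)) (d*[a÷d] (+ 2) {z} (λ ())) (≡.sym reflect) ⟩
  2ℚ * (β * rise (fromℤ z + 1ℚ) k)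
    ∎
  where
  k = 2 ℕ.* j
  z = -[1+ M ℕ.+ k ]
  d = + 2 ÷ z
  c = fromℕ ((suc M ℕ.+ k) C suc M)
  f = fromℕ (k !)
  β = bern k
  w = fromℕ (suc M)
  z≡ : fromℤ z ≡ - (w + fromℕ k)
  z≡ = ≡.trans (fromℤ-neg (+ suc (M ℕ.+ k))) (≡.cong -_ (fromℤ-+ (+ suc M) (+ k)))
  reflect : rise (fromℤ z + 1ℚ) k ≡ rise w k
  reflect = begin
    rise (fromℤ z + 1ℚ) k            ≡⟨ ≡.cong (λ y → rise (y + 1ℚ) k) z≡ ⟩
    rise (- (w + fromℕ k) + 1ℚ) k    ≡⟨ rise-reflect w k ⟩
    (- 1ℚ) ^ k * rise w k            ≡⟨ ≡.cong (_* rise w k) (-1^2n j) ⟩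
    1ℚ * rise w k                    ≡⟨ ℚₚ.*-identityˡ _ ⟩
    rise w k                         ∎

γ-even : ∀ j → bern (2 ℕ.* j) ≡ γ (2 ℕ.* j)
γ-even zero    = ≡.refl
γ-even (suc j) = ≡.trans (≡.sym (ℚₚ.+-identityʳ _)) (≡.cong (λ m → bern (2 ℕ.* suc j) + ½ * t m) (≡.sym (2*suc j)))

pos-2*+ : ∀ i j → + 2 ℤ.* + (i ℕ.+ j) ≡ + 2 ℤ.* + i ℤ.+ + (2 ℕ.* j)
pos-2*+ i j = ≡.trans (ℤₚ.*-distribˡ-+ (+ 2) (+ i) (+ j)) (≡.cong (λ z → + 2 ℤ.* + i ℤ.+ z) (≡.sym (ℤₚ.pos-* 2 j)))

2[i+j]+q : ∀ q i j → + 2 ℤ.* + (i ℕ.+ j) ℤ.+ q ≡ + 2 ℤ.* + i ℤ.+ q ℤ.+ + (2 ℕ.* j)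
2[i+j]+q q i j = ≡.trans (≡.cong (ℤ._+ q) (pos-2*+ i j)) (ℤ+*.solve 3 (λ x y z → x ℤ+*.:+ y ℤ+*.:+ z ℤ+*.:= x ℤ+*.:+ z ℤ+*.:+ y) ≡.refl (+ 2 ℤ.* + i) (+ (2 ℕ.* j)) q)

-- The condition on q is this weak because q = r + s occurs too, which may be even and negative. The
-- sign of 2(i + j) + q selects the case of the definition.
b-value : ∀ q i j → + 2 ℤ.* + (i ℕ.+ j) ℤ.+ q ≢ + 0 →
  fromℤ (+ 2 ℤ.* + (i ℕ.+ j) ℤ.+ q) * b q (+ (i ℕ.+ j)) i
    ≡ 2ℚ * (γ (2 ℕ.* j) * rise (fromℤ (+ 2 ℤ.* + i ℤ.+ q) + 1ℚ) (2 ℕ.* j))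
b-value q i j P≢0 = ≡.trans (cases (ℤₚ.<-cmp P (+ 0))) (≡.cong (λ c → 2ℚ * (c * rise (fromℤ z + 1ℚ) k)) (γ-even j))
  where
  P z : ℤ
  P = + 2 ℤ.* + (i ℕ.+ j) ℤ.+ q
  z = + 2 ℤ.* + i ℤ.+ q
  k : ℕ
  k = 2 ℕ.* j
  Bk : B (2 ℕ.* (i ℕ.+ j ∸ i)) ≡ B k
  Bk = ≡.cong (λ m → B (2 ℕ.* m)) (ℕₚ.m+n∸m≡n i j)
  negative : ∀ {P z} → P ≡ z ℤ.+ + k → P ℤ.< + 0 →
    fromℤ P * ((+ 2 ÷ z) * fromℕ (binom (ℤ.- z) (ℤ.- P)) * B k) ≡ 2ℚ * (bern k * rise (fromℤ z + 1ℚ) k)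
  negative {+ _} _ (ℤ.+<+ ())
  negative { -[1+ M ]} {z} eq _ = ≡.subst (λ z → fromℤ -[1+ M ] * ((+ 2 ÷ z) * fromℕ (binom (ℤ.- z) (+ suc M)) * B k) ≡ 2ℚ * (bern k * rise (fromℤ z + 1ℚ) k)) z≡ (neg-value M j)
    where
    sub : ∀ M k → -[1+ M ℕ.+ k ] ≡ -[1+ M ] ℤ.- + k
    sub M zero    = ≡.cong -[1+_] (ℕₚ.+-identityʳ M)
    sub M (suc k) = ≡.cong -[1+_] (ℕₚ.+-suc M k)
    z≡ : -[1+ M ℕ.+ k ] ≡ z
    z≡ = ≡.trans (sub M k) (≡.trans (≡.cong (ℤ._- + k) eq) (ℤ+*.solve 2 (λ z k → z ℤ+*.:+ k ℤ+*.:- k ℤ+*.:= z) ≡.refl z (+ k)))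
  cases : Tri (P ℤ.< + 0) (P ≡ + 0) (+ 0 ℤ.< P) → fromℤ P * b q (+ (i ℕ.+ j)) i ≡ 2ℚ * (bern k * rise (fromℤ z + 1ℚ) k)
  cases (tri≈ _ P≡0 _) = ⊥-elim (P≢0 P≡0)
  cases (tri> _ _ 0<P) = begin
    fromℤ P * b q (+ (i ℕ.+ j)) i                                               ≡⟨ ≡.cong (fromℤ P *_) (b-pos q (i ℕ.+ j) i (ℕₚ.m≤m+n i j) 0<P) ⟩
    fromℤ P * ((+ 2 ÷ P) * fromℕ (binom P z) * B (2 ℕ.* (i ℕ.+ j ∸ i)))         ≡⟨ ≡.cong (λ β → fromℤ P * ((+ 2 ÷ P) * fromℕ (binom P z) * β)) Bk ⟩
    fromℤ P * ((+ 2 ÷ P) * fromℕ (binom P z) * B k)                             ≡⟨ pos-value z k (2[i+j]+q q i j) 0<P ⟩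
    2ℚ * (bern k * rise (fromℤ z + 1ℚ) k)                                       ∎
  cases (tri< P<0 _ _) = begin
    fromℤ P * b q (+ (i ℕ.+ j)) i                                                             ≡⟨ ≡.cong (fromℤ P *_) (b-neg q (i ℕ.+ j) i (ℕₚ.m≤m+n i j) P<0) ⟩
    fromℤ P * ((+ 2 ÷ z) * fromℕ (binom (ℤ.- z) (ℤ.- P)) * B (2 ℕ.* (i ℕ.+ j ∸ i)))           ≡⟨ ≡.cong (λ β → fromℤ P * ((+ 2 ÷ z) * fromℕ (binom (ℤ.- z) (ℤ.- P)) * β)) Bk ⟩
    fromℤ P * ((+ 2 ÷ z) * fromℕ (binom (ℤ.- z) (ℤ.- P)) * B k)                               ≡⟨ negative {P} {z} (2[i+j]+q q i j) P<0 ⟩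
    2ℚ * (bern k * rise (fromℤ z + 1ℚ) k)                                                     ∎

-- Otherwise q = -2n, an even number that is not positive. This is how the hypotheses on r and s
-- enter: it allows cancellation of x, of y, and of the factor 2n + q for q = r and q = s.
PositiveOrOdd⇒2n+q≢0 : ∀ {q} → PositiveOrOdd q → ∀ n → + 2 ℤ.* + n ℤ.+ q ≢ + 0
PositiveOrOdd⇒2n+q≢0 {q} (inj₁ 0<q) n eq = ℤₚ.<⇒≢ (ℤₚ.+-mono-≤-< 0≤2n 0<q) (≡.sym eq)
  where
  0≤2n : + 0 ℤ.≤ + 2 ℤ.* + n
  0≤2n = ≡.subst (+ 0 ℤ.≤_) (ℤₚ.pos-* 2 n) (ℤ.+≤+ ℕ.z≤n)
PositiveOrOdd⇒2n+q≢0 {q} (inj₂ odd) n eq = odd (ℕ.divides n (begin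
  ℤ.∣ q ∣                  ≡⟨ ≡.cong ℤ.∣_∣ (ℤ+*.solve 2 (λ q m → q ℤ+*.:= ℤ+*.:- m ℤ+*.:+ (m ℤ+*.:+ q)) ≡.refl q (+ 2 ℤ.* + n)) ⟩
  ℤ.∣ ℤ.- (+ 2 ℤ.* + n) ℤ.+ (+ 2 ℤ.* + n ℤ.+ q) ∣ ≡⟨ ≡.cong (λ z → ℤ.∣ ℤ.- (+ 2 ℤ.* + n) ℤ.+ z ∣) eq ⟩
  ℤ.∣ ℤ.- (+ 2 ℤ.* + n) ℤ.+ + 0 ∣ ≡⟨ ≡.cong ℤ.∣_∣ (ℤₚ.+-identityʳ (ℤ.- (+ 2 ℤ.* + n))) ⟩
  ℤ.∣ ℤ.- (+ 2 ℤ.* + n) ∣  ≡⟨ ℤₚ.∣-i∣≡∣i∣ (+ 2 ℤ.* + n) ⟩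
  ℤ.∣ + 2 ℤ.* + n ∣        ≡⟨ ℤₚ.abs-* (+ 2) (+ n) ⟩
  2 ℕ.* n                  ≡⟨ ℕₚ.*-comm 2 n ⟩
  n ℕ.* 2                  ∎))

-- The multiplier in `b-value` depends on the upper index i + j. Since x (x + 1)⁽ᵏ⁾ = (x + k) x⁽ᵏ⁾
-- with x + k equal to that multiplier, it cancels and leaves x, which is common to all terms of a
-- sum over the upper index.
b-rise : ∀ {q} → PositiveOrOdd q → ∀ i j → let x = fromℤ (+ 2 ℤ.* + i ℤ.+ q) in
  x * b q (+ (i ℕ.+ j)) i ≡ 2ℚ * (γ (2 ℕ.* j) * rise x (2 ℕ.* j))
b-rise {q} h i j = fromℤ-*-cancelˡ P≢0 (begin
  fromℤ P * (x * v)                                ≡⟨ solve 3 (λ p x v → p :* (x :* v) := x :* (p :* v)) ≡.refl (fromℤ P) x v ⟩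
  x * (fromℤ P * v)                                ≡⟨ ≡.cong (x *_) (b-value q i j P≢0) ⟩
  x * (2ℚ * (γ k * rise (x + 1ℚ) k))               ≡⟨ solve 4 (λ x two c r → x :* (two :* (c :* r)) := two :* (c :* (x :* r))) ≡.refl x 2ℚ (γ k) (rise (x + 1ℚ) k) ⟩
  2ℚ * (γ k * (x * rise (x + 1ℚ) k))               ≡⟨ ≡.cong (λ r → 2ℚ * (γ k * r)) (rise-suc x k) ⟩
  2ℚ * (γ k * ((x + fromℕ k) * rise x k))          ≡⟨ ≡.cong (λ p → 2ℚ * (γ k * (p * rise x k))) (≡.trans (≡.sym (fromℤ-+ (+ 2 ℤ.* + i ℤ.+ q) (+ k))) (≡.cong fromℤ (≡.sym (2[i+j]+q q i j)))) ⟩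
  2ℚ * (γ k * (fromℤ P * rise x k))                ≡⟨ solve 4 (λ p two c r → two :* (c :* (p :* r)) := p :* (two :* (c :* r))) ≡.refl (fromℤ P) 2ℚ (γ k) (rise x k) ⟩
  fromℤ P * (2ℚ * (γ k * rise x k))                ∎)
  where
  P = + 2 ℤ.* + (i ℕ.+ j) ℤ.+ q
  P≢0 = PositiveOrOdd⇒2n+q≢0 h (i ℕ.+ j)
  x = fromℤ (+ 2 ℤ.* + i ℤ.+ q)
  k = 2 ℕ.* j
  v = b q (+ (i ℕ.+ j)) i

b-vanish : ∀ q {z i} → z ℤ.< + i → b q z i ≡ 0ℚ
b-vanish q { -[1+ _ ]} _          = ≡.refl
b-vanish q {+ n} {i} (ℤ.+<+ n<i) rewrite T⇒≡true (ℕₚ.<⇒<ᵇ n<i) = ≡.refl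

-- Reduction of the theorem

conv-shiftˡ : ∀ a n F → (∀ i j → i ℕ.< a → F i j ≡ 0ℚ) → conv (a ℕ.+ n) F ≡ conv n (λ i j → F (a ℕ.+ i) j)
conv-shiftˡ zero    n F _   = ≡.refl
conv-shiftˡ (suc a) n F F≡0 = begin
  F 0 (suc (a ℕ.+ n)) + conv (a ℕ.+ n) (λ i j → F (suc i) j)   ≡⟨ ≡.cong (_+ conv (a ℕ.+ n) (λ i j → F (suc i) j)) (F≡0 0 (suc (a ℕ.+ n)) ℕ.z<s) ⟩
  0ℚ + conv (a ℕ.+ n) (λ i j → F (suc i) j)                    ≡⟨ ℚₚ.+-identityˡ _ ⟩
  conv (a ℕ.+ n) (λ i j → F (suc i) j)                         ≡⟨ conv-shiftˡ a n _ (λ i j i<a → F≡0 (suc i) j (ℕ.s<s i<a)) ⟩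
  conv n (λ i j → F (suc a ℕ.+ i) j)                           ∎

conv-shiftʳ : ∀ a n F → (∀ i j → j ℕ.< a → F i j ≡ 0ℚ) → conv (a ℕ.+ n) F ≡ conv n (λ i j → F i (a ℕ.+ j))
conv-shiftʳ a n F F≡0 = begin
  conv (a ℕ.+ n) F                   ≡⟨ conv-flip (a ℕ.+ n) F ⟩
  conv (a ℕ.+ n) (λ i j → F j i)     ≡⟨ conv-shiftˡ a n _ (λ i j → F≡0 j i) ⟩
  conv n (λ i j → F j (a ℕ.+ i))     ≡⟨ conv-flip n _ ⟩
  conv n (λ i j → F i (a ℕ.+ j))     ∎

module _ (α β : ℕ) (f : ℕ → ℕ → ℚ) where
  private
    summand : ℕ → ℕ → ℚ
    summand ℓ m = if (α ℕ.≤ᵇ ℓ) ∧ (β ℕ.≤ᵇ m) then f ℓ m else 0ℚ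

    ≰ᵇ : ∀ {a i} → i ℕ.< a → (a ℕ.≤ᵇ i) ≡ false
    ≰ᵇ {a} {i} i<a = ¬T⇒≡false (λ c → ℕₚ.<⇒≱ i<a (ℕₚ.≤ᵇ⇒≤ a i c))

    vanishˡ : ∀ ℓ m → ℓ ℕ.< α → summand ℓ m ≡ 0ℚ
    vanishˡ ℓ m ℓ<α rewrite ≰ᵇ ℓ<α = ≡.refl

    vanishʳ : ∀ ℓ m → m ℕ.< β → summand ℓ m ≡ 0ℚ
    vanishʳ ℓ m m<β rewrite ≰ᵇ m<β | ∧-zeroʳ (α ℕ.≤ᵇ ℓ) = ≡.refl

    inside : ∀ u v → summand (α ℕ.+ u) (β ℕ.+ v) ≡ f (α ℕ.+ u) (β ℕ.+ v)
    inside u v rewrite T⇒≡true (ℕₚ.≤⇒≤ᵇ (ℕₚ.m≤m+n α u)) | T⇒≡true (ℕₚ.≤⇒≤ᵇ (ℕₚ.m≤m+n β v)) = ≡.refl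

  sumSplit-vanish : ∀ n → n ℕ.< α ℕ.+ β → sumSplit n α β f ≡ 0ℚ
  sumSplit-vanish n n<α+β = ≡.trans (∑≡conv n summand) (conv-0 n term)
    where
    term : ∀ ℓ m → ℓ ℕ.+ m ≡ n → summand ℓ m ≡ 0ℚ
    term ℓ m ≡.refl with ℓ ℕₚ.<? α
    ... | yes ℓ<α = vanishˡ ℓ m ℓ<α
    ... | no  ℓ≮α = vanishʳ ℓ m (ℕₚ.+-cancelˡ-< α m β (ℕₚ.≤-<-trans (ℕₚ.+-monoˡ-≤ m (ℕₚ.≮⇒≥ ℓ≮α)) n<α+β))

  sumSplit-shift : ∀ n → sumSplit (α ℕ.+ β ℕ.+ n) α β f ≡ conv n (λ u v → f (α ℕ.+ u) (β ℕ.+ v))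
  sumSplit-shift n = begin
    sumSplit (α ℕ.+ β ℕ.+ n) α β f                     ≡⟨ ∑≡conv (α ℕ.+ β ℕ.+ n) summand ⟩
    conv (α ℕ.+ β ℕ.+ n) summand                       ≡⟨ ≡.cong (λ m → conv m summand) (ℕₚ.+-assoc α β n) ⟩
    conv (α ℕ.+ (β ℕ.+ n)) summand                     ≡⟨ conv-shiftˡ α (β ℕ.+ n) summand vanishˡ ⟩
    conv (β ℕ.+ n) (λ u m → summand (α ℕ.+ u) m)       ≡⟨ conv-shiftʳ β n (λ u m → summand (α ℕ.+ u) m) (λ u m → vanishʳ (α ℕ.+ u) m) ⟩
    conv n (λ u v → summand (α ℕ.+ u) (β ℕ.+ v))       ≡⟨ conv-cong′ n inside ⟩
    conv n (λ u v → f (α ℕ.+ u) (β ℕ.+ v))             ∎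

δ-≡ : ∀ {i j} → i ≡ j → δ i j ≡ 1ℚ
δ-≡ {i} {j} i≡j rewrite dec-true (i ℤₚ.≟ j) i≡j = ≡.refl

δ-≢ : ∀ {i j} → i ≢ j → δ i j ≡ 0ℚ
δ-≢ {i} {j} i≢j rewrite dec-false (i ℤₚ.≟ j) i≢j = ≡.refl

m≡n-1⇒n≡1+m : ∀ {m n} → + m ≡ + n ℤ.- + 1 → n ≡ suc m
m≡n-1⇒n≡1+m {m} {n} eq = ℤₚ.+-injective (≡.trans (ℤ+*.solve 1 (λ n → n ℤ+*.:= ℤ+*.con (+ 1) ℤ+*.:+ (n ℤ+*.:- ℤ+*.con (+ 1))) ≡.refl (+ n)) (≡.cong (λ z → + 1 ℤ.+ z) (≡.sym eq)))

-- With m = α + β the delta is 1 exactly for excess n = 1, that is in degree 2n = 2, where the form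
-- is x y / 4. The factor 4 is the one that a product of two values from `b-rise` carries.
quadratic-δ : ∀ m n x y → x * y * δ (+ m) (+ (m ℕ.+ n) ℤ.- + 1) ≡ 2ℚ * 2ℚ * quadratic (2 ℕ.* n) x y
quadratic-δ m n x y = begin
  x * y * δ (+ m) (+ (m ℕ.+ n) ℤ.- + 1)   ≡⟨ ≡.cong (x * y *_) (δ≡𝟙 n) ⟩
  x * y * t n                             ≡⟨ value n ⟩
  2ℚ * 2ℚ * quadratic (2 ℕ.* n) x y       ∎
  where
  off-diagonal : ∀ n → n ≢ 1 → δ (+ m) (+ (m ℕ.+ n) ℤ.- + 1) ≡ 0ℚ
  off-diagonal n n≢1 = δ-≢ (λ eq → n≢1 (ℕₚ.+-cancelˡ-≡ m n 1 (≡.trans (m≡n-1⇒n≡1+m eq) (ℕₚ.+-comm 1 m))))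
  -- The series `t` serves as the indicator of the index 1.
  δ≡𝟙 : ∀ n → δ (+ m) (+ (m ℕ.+ n) ℤ.- + 1) ≡ t n
  δ≡𝟙 0             = off-diagonal 0 (λ ())
  δ≡𝟙 1             = δ-≡ (≡.sym (ℤ+*.solve 1 (λ m → m ℤ+*.:+ ℤ+*.con (+ 1) ℤ+*.:- ℤ+*.con (+ 1) ℤ+*.:= m) ≡.refl (+ m)))
  δ≡𝟙 (suc (suc n)) = off-diagonal (suc (suc n)) (λ ())
  value : ∀ n → x * y * t n ≡ 2ℚ * 2ℚ * quadratic (2 ℕ.* n) x y
  value 0             = ℚₚ.*-zeroʳ (x * y)
  value 1             = solve 2 (λ x y → x :* y :* con 1ℚ := con (2ℚ * 2ℚ) :* (con ½ :* (con ½ :* (x :* (y :* con 1ℚ))))) ≡.refl x y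
  value (suc (suc n)) = ≡.trans (ℚₚ.*-zeroʳ (x * y)) (≡.cong (λ k → 2ℚ * 2ℚ * quadratic k x y) {suc (suc (suc (suc (2 ℕ.* n))))} (≡.sym (≡.trans (2*suc (suc n)) (≡.cong (λ k → suc (suc k)) (2*suc n)))))

-- The right-hand sum, and clearing of denominators

module _ (r s : ℤ) (α β : ℕ) where
  summand : ℕ → ℕ → ℚ
  summand n k = b (r ℤ.+ s) (+ n) k * (b r (+ k ℤ.- + β) α + b s (+ k ℤ.- + α) β)

  private
    k-c<a : ∀ {k} a c → k ℕ.< a ℕ.+ c → + k ℤ.- + c ℤ.< + a
    k-c<a {k} a c k<a+c = ≡.subst (+ k ℤ.- + c ℤ.<_) (ℤ+*.solve 2 (λ a c → a ℤ+*.:+ c ℤ+*.:- c ℤ+*.:= a) ≡.refl (+ a) (+ c)) (ℤₚ.+-monoˡ-< (ℤ.- + c) (ℤ.+<+ k<a+c))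

    -- Below α + β one has both k - β < α and k - α < β, so both terms in the bracket are 0 by
    -- convention.
    summand-vanish : ∀ n k → k ℕ.< α ℕ.+ β → summand n k ≡ 0ℚ
    summand-vanish n k k<α+β = ≡.trans
      (≡.cong₂ (λ p q → b (r ℤ.+ s) (+ n) k * (p + q)) (b-vanish r (k-c<a α β k<α+β)) (b-vanish s (k-c<a β α (≡.subst (k ℕ.<_) (ℕₚ.+-comm α β) k<α+β))))
      (ℚₚ.*-zeroʳ (b (r ℤ.+ s) (+ n) k))

  ∑summand-vanish : ∀ n → n ℕ.< α ℕ.+ β → (∑[ k ≤ n ] summand n (toℕ k)) ≡ 0ℚ
  ∑summand-vanish n n<α+β = ≡.trans (∑≡conv n (λ k _ → summand n k))
    (conv-0 n (λ k j k+j≡n → summand-vanish n k (ℕₚ.≤-<-trans (≡.subst (k ℕ.≤_) k+j≡n (ℕₚ.m≤m+n k j)) n<α+β)))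

  ∑summand-shift : ∀ n → (∑[ k ≤ α ℕ.+ β ℕ.+ n ] summand (α ℕ.+ β ℕ.+ n) (toℕ k)) ≡ conv n (λ k w → summand (α ℕ.+ β ℕ.+ n) (α ℕ.+ β ℕ.+ w))
  ∑summand-shift n = begin
    (∑[ k ≤ N ] summand N (toℕ k))                     ≡⟨ ∑≡conv N (λ k _ → summand N k) ⟩
    conv N (λ k _ → summand N k)                       ≡⟨ conv-shiftˡ (α ℕ.+ β) n (λ k _ → summand N k) (λ k _ → summand-vanish N k) ⟩
    conv n (λ w _ → summand N (α ℕ.+ β ℕ.+ w))         ≡⟨ conv-flip n (λ w _ → summand N (α ℕ.+ β ℕ.+ w)) ⟩
    conv n (λ k w → summand N (α ℕ.+ β ℕ.+ w))         ∎
    where N = α ℕ.+ β ℕ.+ n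

  private
    x y : ℤ
    x = + 2 ℤ.* + α ℤ.+ r
    y = + 2 ℤ.* + β ℤ.+ s
    X Y : ℚ
    X = fromℤ x
    Y = fromℤ y

  module _ (hr : PositiveOrOdd r) (hs : PositiveOrOdd s) (n : ℕ) (D≢0 : + 2 ℤ.* + (α ℕ.+ β ℕ.+ n) ℤ.+ (r ℤ.+ s) ≢ + 0) where
    private
      d : ℤ
      d = + 2 ℤ.* + (α ℕ.+ β ℕ.+ n) ℤ.+ (r ℤ.+ s)
      D : ℚ
      D = fromℤ d

      D≡ : D ≡ X + Y + fromℕ (2 ℕ.* n)
      D≡ = ≡.trans (≡.cong fromℤ d≡) (≡.trans (fromℤ-+ (x ℤ.+ y) (+ (2 ℕ.* n))) (≡.cong (_+ fromℕ (2 ℕ.* n)) (fromℤ-+ x y)))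
        where
        d≡ : d ≡ x ℤ.+ y ℤ.+ + (2 ℕ.* n)
        d≡ = ≡.trans (ℤ+*.solve 5 (λ a c m r s → ℤ+*.con (+ 2) ℤ+*.:* (a ℤ+*.:+ c ℤ+*.:+ m) ℤ+*.:+ (r ℤ+*.:+ s)
               ℤ+*.:= (ℤ+*.con (+ 2) ℤ+*.:* a ℤ+*.:+ r) ℤ+*.:+ (ℤ+*.con (+ 2) ℤ+*.:* c ℤ+*.:+ s) ℤ+*.:+ ℤ+*.con (+ 2) ℤ+*.:* m) ≡.refl (+ α) (+ β) (+ n) r s)
               (≡.cong (λ z → x ℤ.+ y ℤ.+ z) (≡.sym (ℤₚ.pos-* 2 n)))

      base≡ : ∀ w → fromℤ (+ 2 ℤ.* + (α ℕ.+ β ℕ.+ w) ℤ.+ (r ℤ.+ s)) + 1ℚ ≡ X + Y + fromℕ (suc (2 ℕ.* w))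
      base≡ w = ≡.trans (≡.sym (fromℤ-+ (+ 2 ℤ.* + (α ℕ.+ β ℕ.+ w) ℤ.+ (r ℤ.+ s)) (+ 1))) (≡.trans (≡.cong fromℤ eq) (≡.trans (fromℤ-+ (x ℤ.+ y) (+ suc (2 ℕ.* w))) (≡.cong (_+ fromℕ (suc (2 ℕ.* w))) (fromℤ-+ x y))))
        where
        eq : + 2 ℤ.* + (α ℕ.+ β ℕ.+ w) ℤ.+ (r ℤ.+ s) ℤ.+ + 1 ≡ x ℤ.+ y ℤ.+ + suc (2 ℕ.* w)
        eq = ≡.trans (ℤ+*.solve 5 (λ a c m r s → ℤ+*.con (+ 2) ℤ+*.:* (a ℤ+*.:+ c ℤ+*.:+ m) ℤ+*.:+ (r ℤ+*.:+ s) ℤ+*.:+ ℤ+*.con (+ 1)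
               ℤ+*.:= (ℤ+*.con (+ 2) ℤ+*.:* a ℤ+*.:+ r) ℤ+*.:+ (ℤ+*.con (+ 2) ℤ+*.:* c ℤ+*.:+ s) ℤ+*.:+ (ℤ+*.con (+ 1) ℤ+*.:+ ℤ+*.con (+ 2) ℤ+*.:* m)) ≡.refl (+ α) (+ β) (+ w) r s)
               (≡.cong (λ z → x ℤ.+ y ℤ.+ (+ 1 ℤ.+ z)) (≡.sym (ℤₚ.pos-* 2 w)))

      D*b : ∀ k w → k ℕ.+ w ≡ n → D * b (r ℤ.+ s) (+ (α ℕ.+ β ℕ.+ n)) (α ℕ.+ β ℕ.+ w)
        ≡ 2ℚ * (γ (2 ℕ.* k) * rise (X + Y + fromℕ (suc (2 ℕ.* w))) (2 ℕ.* k))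
      D*b k w k+w≡n = ≡.trans (rebased index) (≡.cong (λ z → 2ℚ * (γ (2 ℕ.* k) * rise z (2 ℕ.* k))) (base≡ w))
        where
        index : α ℕ.+ β ℕ.+ w ℕ.+ k ≡ α ℕ.+ β ℕ.+ n
        index = ≡.trans (ℕₚ.+-assoc (α ℕ.+ β) w k) (≡.cong (λ m → α ℕ.+ β ℕ.+ m) (≡.trans (ℕₚ.+-comm w k) k+w≡n))
        -- The upper index is generalised to `m` so that it can be matched with the form i + j that
        -- `b-value` requires.
        rebased : ∀ {m} → α ℕ.+ β ℕ.+ w ℕ.+ k ≡ m → fromℤ (+ 2 ℤ.* + m ℤ.+ (r ℤ.+ s)) * b (r ℤ.+ s) (+ m) (α ℕ.+ β ℕ.+ w)
          ≡ 2ℚ * (γ (2 ℕ.* k) * rise (fromℤ (+ 2 ℤ.* + (α ℕ.+ β ℕ.+ w) ℤ.+ (r ℤ.+ s)) + 1ℚ) (2 ℕ.* k))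
        rebased ≡.refl = b-value (r ℤ.+ s) (α ℕ.+ β ℕ.+ w) k (≡.subst (λ m → + 2 ℤ.* + m ℤ.+ (r ℤ.+ s) ≢ + 0) (≡.sym index) D≢0)

      four : ℚ
      four = 2ℚ * 2ℚ

      Δ : ℚ
      Δ = δ (+ (α ℕ.+ β)) (+ (α ℕ.+ β ℕ.+ n) ℤ.- + 1)

      productTerm crossTerm : ℕ → ℕ → ℚ
      productTerm u v = γ (2 ℕ.* u) * rise X (2 ℕ.* u) * (γ (2 ℕ.* v) * rise Y (2 ℕ.* v))
      crossTerm k w = γ (2 ℕ.* k) * (rise (X + Y + fromℕ (suc (2 ℕ.* w))) (2 ℕ.* k) * cross (2 ℕ.* w) X Y)

      -- `X` clears the values of b for r and `Y` those for s, each uniformly in the summation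
      -- index, while `D` stays as the factor x + y + 2N.
      left : D * (X * (Y * (Δ + conv n (λ u v → b r (+ (α ℕ.+ u)) α * b s (+ (β ℕ.+ v)) β))))
        ≡ four * (D * (conv n productTerm + quadratic (2 ℕ.* n) X Y))
      left = begin
        D * (X * (Y * (Δ + C)))
          ≡⟨ solve 5 (λ D X Y Δ C → D :* (X :* (Y :* (Δ :+ C))) := D :* (X :* Y :* C :+ X :* Y :* Δ)) ≡.refl D X Y Δ C ⟩
        D * (X * Y * C + X * Y * Δ)
          ≡⟨ ≡.cong₂ (λ p q → D * (p + q)) products (quadratic-δ (α ℕ.+ β) n X Y) ⟩
        D * (four * conv n productTerm + four * quadratic (2 ℕ.* n) X Y)
          ≡⟨ solve 4 (λ D f p q → D :* (f :* p :+ f :* q) := f :* (D :* (p :+ q))) ≡.refl D four (conv n productTerm) (quadratic (2 ℕ.* n) X Y) ⟩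
        four * (D * (conv n productTerm + quadratic (2 ℕ.* n) X Y))
          ∎
        where
        bʳ bˢ : ℕ → ℚ
        bʳ u = b r (+ (α ℕ.+ u)) α
        bˢ v = b s (+ (β ℕ.+ v)) β
        C : ℚ
        C = conv n (λ u v → bʳ u * bˢ v)
        products : X * Y * C ≡ four * conv n productTerm
        products = begin
          X * Y * C                                 ≡⟨ conv-*ˡ n (X * Y) (λ u v → bʳ u * bˢ v) ⟩
          conv n (λ u v → X * Y * (bʳ u * bˢ v))    ≡⟨ conv-cong′ n (λ u v → begin
            X * Y * (bʳ u * bˢ v)                     ≡⟨ solve 4 (λ X Y p q → X :* Y :* (p :* q) := X :* p :* (Y :* q)) ≡.refl X Y (bʳ u) (bˢ v) ⟩
            X * bʳ u * (Y * bˢ v)                     ≡⟨ ≡.cong₂ _*_ (b-rise hr α u) (b-rise hs β v) ⟩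
            _                                         ≡⟨ solve 3 (λ two p q → two :* p :* (two :* q) := two :* two :* (p :* q)) ≡.refl 2ℚ (γ (2 ℕ.* u) * rise X (2 ℕ.* u)) (γ (2 ℕ.* v) * rise Y (2 ℕ.* v)) ⟩
            four * productTerm u v                    ∎) ⟩
          conv n (λ u v → four * productTerm u v)   ≡⟨ conv-*ˡ n four productTerm ⟨
          four * conv n productTerm                 ∎

      -- Here `D` is spent on the value of b for r + s. Of `X` and `Y`, one clears the b in each
      -- bracket term and the other survives, which gives the shape of `cross`.
      right : ∀ k w → k ℕ.+ w ≡ n → D * (X * (Y * summand (α ℕ.+ β ℕ.+ n) (α ℕ.+ β ℕ.+ w))) ≡ four * crossTerm k w
      right k w k+w≡n = begin
        D * (X * (Y * (bᴰ * (b r (+ (α ℕ.+ β ℕ.+ w) ℤ.- + β) α + b s (+ (α ℕ.+ β ℕ.+ w) ℤ.- + α) β))))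
          ≡⟨ ≡.cong₂ (λ i j → D * (X * (Y * (bᴰ * (b r i α + b s j β)))))
               (ℤ+*.solve 3 (λ a c w → a ℤ+*.:+ c ℤ+*.:+ w ℤ+*.:- c ℤ+*.:= a ℤ+*.:+ w) ≡.refl (+ α) (+ β) (+ w))
               (ℤ+*.solve 3 (λ a c w → a ℤ+*.:+ c ℤ+*.:+ w ℤ+*.:- a ℤ+*.:= c ℤ+*.:+ w) ≡.refl (+ α) (+ β) (+ w)) ⟩
        D * (X * (Y * (bᴰ * (bʳ + bˢ))))
          ≡⟨ solve 6 (λ D X Y p q r → D :* (X :* (Y :* (p :* (q :+ r)))) := D :* p :* (Y :* (X :* q) :+ X :* (Y :* r))) ≡.refl D X Y bᴰ bʳ bˢ ⟩
        D * bᴰ * (Y * (X * bʳ) + X * (Y * bˢ))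
          ≡⟨ ≡.cong₂ _*_ (D*b k w k+w≡n) (≡.cong₂ (λ p q → Y * p + X * q) (b-rise hr α w) (b-rise hs β w)) ⟩
        2ℚ * (γ (2 ℕ.* k) * R) * (Y * (2ℚ * p) + X * (2ℚ * q))
          ≡⟨ solve 7 (λ two c R X Y p q → two :* (c :* R) :* (Y :* (two :* p) :+ X :* (two :* q)) := two :* two :* (c :* (R :* (Y :* p :+ X :* q)))) ≡.refl 2ℚ (γ (2 ℕ.* k)) R X Y p q ⟩
        four * crossTerm k w
          ∎
        where
        bᴰ bʳ bˢ R p q : ℚ
        bᴰ = b (r ℤ.+ s) (+ (α ℕ.+ β ℕ.+ n)) (α ℕ.+ β ℕ.+ w)
        bʳ = b r (+ (α ℕ.+ w)) α
        bˢ = b s (+ (β ℕ.+ w)) β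
        R = rise (X + Y + fromℕ (suc (2 ℕ.* w))) (2 ℕ.* k)
        p = γ (2 ℕ.* w) * rise X (2 ℕ.* w)
        q = γ (2 ℕ.* w) * rise Y (2 ℕ.* w)

      D*X*Y-conv : ∀ F → D * (X * (Y * conv n F)) ≡ conv n (λ k w → D * (X * (Y * F k w)))
      D*X*Y-conv F = ≡.trans (≡.cong (λ z → D * (X * z)) (conv-*ˡ n Y F))
        (≡.trans (≡.cong (D *_) (conv-*ˡ n X (λ k w → Y * F k w))) (conv-*ˡ n D (λ k w → X * (Y * F k w))))

    -- This is the theorem after the substitution ℓ = α + u, m = β + v, k = α + β + w, which drops
    -- the vanishing terms.
    shifted-identity : Δ + conv n (λ u v → b r (+ (α ℕ.+ u)) α * b s (+ (β ℕ.+ v)) β)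
      ≡ conv n (λ k w → summand (α ℕ.+ β ℕ.+ n) (α ℕ.+ β ℕ.+ w))
    shifted-identity =
      fromℤ-*-cancelˡ {y} (PositiveOrOdd⇒2n+q≢0 hs β)
        (fromℤ-*-cancelˡ {x} (PositiveOrOdd⇒2n+q≢0 hr α)
          (fromℤ-*-cancelˡ {d} D≢0 (begin
            D * (X * (Y * (Δ + conv n (λ u v → b r (+ (α ℕ.+ u)) α * b s (+ (β ℕ.+ v)) β))))
              ≡⟨ left ⟩
            four * (D * (conv n productTerm + quadratic (2 ℕ.* n) X Y))
              ≡⟨ ≡.cong (λ z → four * (z * (conv n productTerm + quadratic (2 ℕ.* n) X Y))) D≡ ⟩
            four * ((X + Y + fromℕ (2 ℕ.* n)) * (conv n productTerm + quadratic (2 ℕ.* n) X Y))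
              ≡⟨ ≡.cong (four *_) (rise-convolution-even n X Y) ⟩
            four * conv n crossTerm
              ≡⟨ conv-*ˡ n four crossTerm ⟩
            conv n (λ k w → four * crossTerm k w)
              ≡⟨ conv-cong n right ⟨
            conv n (λ k w → D * (X * (Y * summand (α ℕ.+ β ℕ.+ n) (α ℕ.+ β ℕ.+ w))))
              ≡⟨ D*X*Y-conv (λ k w → summand (α ℕ.+ β ℕ.+ n) (α ℕ.+ β ℕ.+ w)) ⟨
            D * (X * (Y * conv n (λ k w → summand (α ℕ.+ β ℕ.+ n) (α ℕ.+ β ℕ.+ w))))
              ∎)))

theorem6p2 : (r s : ℤ) → PositiveOrOdd r → PositiveOrOdd s →
    (n : ℕ) → + 2 ℤ.* + n ≢ ℤ.- (r ℤ.+ s) →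
    (α β : ℕ) → α ℕ.≤ n → β ℕ.≤ n →
    δ (+ (α ℕ.+ β)) (+ n ℤ.- + 1) + sumSplit n α β (λ ℓ m → b r (+ ℓ) α * b s (+ m) β)
    ≡ (∑[ k ≤ n ] (b (r ℤ.+ s) (+ n) (toℕ k) * (b r (+ toℕ k ℤ.- + β) α + b s (+ toℕ k ℤ.- + α) β)))
theorem6p2 r s hr hs n n≢ α β _ _ = identity n n≢ (n ℕₚ.<? α ℕ.+ β)
  where
  f : ℕ → ℕ → ℚ
  f ℓ m = b r (+ ℓ) α * b s (+ m) β

  Identity : ℕ → Set
  Identity n = δ (+ (α ℕ.+ β)) (+ n ℤ.- + 1) + sumSplit n α β f ≡ (∑[ k ≤ n ] summand r s α β n (toℕ k))

  above : ∀ N → + 2 ℤ.* + (α ℕ.+ β ℕ.+ N) ≢ ℤ.- (r ℤ.+ s) → Identity (α ℕ.+ β ℕ.+ N)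
  above N n≢ = begin
    Δ + sumSplit M α β f
      ≡⟨ ≡.cong (λ z → Δ + z) (sumSplit-shift α β f N) ⟩
    Δ + conv N (λ u v → f (α ℕ.+ u) (β ℕ.+ v))
      ≡⟨ shifted-identity r s α β hr hs N D≢0 ⟩
    conv N (λ k w → summand r s α β M (α ℕ.+ β ℕ.+ w))
      ≡⟨ ∑summand-shift r s α β N ⟨
    (∑[ k ≤ M ] summand r s α β M (toℕ k))
      ∎
    where
    M : ℕ
    M = α ℕ.+ β ℕ.+ N
    Δ : ℚ
    Δ = δ (+ (α ℕ.+ β)) (+ M ℤ.- + 1)
    D≢0 : + 2 ℤ.* + M ℤ.+ (r ℤ.+ s) ≢ + 0
    D≢0 eq = n≢ (≡.trans (ℤ+*.solve 2 (λ m q → m ℤ+*.:= (m ℤ+*.:+ q) ℤ+*.:- q) ≡.refl (+ 2 ℤ.* + M) (r ℤ.+ s))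
      (≡.trans (≡.cong (ℤ._- (r ℤ.+ s)) eq) (ℤₚ.+-identityˡ (ℤ.- (r ℤ.+ s)))))

  identity : ∀ n → + 2 ℤ.* + n ≢ ℤ.- (r ℤ.+ s) → Dec (n ℕ.< α ℕ.+ β) → Identity n
  identity n _ (yes n<α+β) = begin
    δ (+ (α ℕ.+ β)) (+ n ℤ.- + 1) + sumSplit n α β f
      -- The delta vanishes as well, because α + β = n - 1 would give n > α + β.
      ≡⟨ ≡.cong₂ _+_ (δ-≢ (λ eq → ℕₚ.<-asym n<α+β (ℕₚ.≤-reflexive (≡.sym (m≡n-1⇒n≡1+m eq))))) (sumSplit-vanish α β f n n<α+β) ⟩
    0ℚ
      ≡⟨ ∑summand-vanish r s α β n n<α+β ⟨
    (∑[ k ≤ n ] summand r s α β n (toℕ k))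
      ∎
  identity n n≢ (no n≮α+β) = shifted (ℕₚ.m≤n⇒∃[o]m+o≡n (ℕₚ.≮⇒≥ n≮α+β)) n≢
    where
    shifted : ∀ {n} → (∃ λ N → α ℕ.+ β ℕ.+ N ≡ n) → + 2 ℤ.* + n ≢ ℤ.- (r ℤ.+ s) → Identity n
    shifted (N , ≡.refl) = above N
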